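{- For all real $\alpha,\beta$ with $\beta\neq0$, every integer $n\ge0$ and every real $x>0$, \[ P_n^{(\alpha,\beta)}(x^{\beta})=(-1)^n x^{n-\alpha}e^{ -x^{\beta}}\Big(\frac{d}{dx}\Big)^n\big(x^{\alpha}e^{x^{\beta}}\big), \qquad P_n^{(\alpha,\beta)}(x^{ -\beta})=x^{\alpha+1}e^{ -x^{ -\beta}}\Big(\frac{d}{dx}\Big)^n\big(x^{n-1-\alpha}e^{x^{ -\beta}}\big). \]
   Context: For real $\alpha,\beta$ with $\beta\neq0$, the polynomials $P_n^{(\alpha,\beta)}(x)$, $n\ge0$, are defined by $\sum_{n\ge0}P_n^{(\alpha,\beta)}(x)\frac{t^n}{n!}=(1-t)^{\alpha}\exp\big(x((1-t)^{\beta}-1)\big)$ (formal power series in $t$). Real powers $x^{\gamma}$ of $x>0$ are the usual positive real powers. -}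

module Defs where

open import Level using (Level; _⊔_) renaming (suc to lsuc)
open import Algebra.Apartness.Bundles using (HeytingField; HeytingCommutativeRing)
open import Algebra.Bundles using (CommutativeRing)
open import Data.Fin.Base using (toℕ)
open import Data.Nat.Base as ℕ using (ℕ; zero; suc; NonZero; _!; _∸_)
open import Data.Nat.Properties using (_!≢0)
open import Data.Product.Base using (Σ; ∃; _×_; _,_; proj₁)
open import Data.Sum.Base using (_⊎_; inj₂)
open import Relation.Binary.Core using (Rel)
open import Relation.Binary.Structures using (IsStrictPartialOrder)
import Algebra.Properties.CommutativeMonoid.Sum as Sum
import Algebra.Properties.Semiring.Exp as Exp
import Algebra.Properties.Semiring.Mult as Mult

-- The real numbers, axiomatised as a Cauchy-complete Archimedean ordered
-- field.  Up to isomorphism there is classically exactly one such field.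
-- The axioms avoid trichotomy, so that Cauchy reals are a model without
-- excluded middle; cotransitivity of _<_ follows from that of _#_.  As there
-- is no decidable order, ∣x - y∣ < ε is spelled as the two-sided inequality.
record RealField (c ℓ₁ ℓ₂ : Level) : Set (lsuc (c ⊔ ℓ₁ ⊔ ℓ₂)) where
  infix 4 _<_
  field
    heytingField : HeytingField c ℓ₁ ℓ₂

  open HeytingField heytingField public

  commutativeRing : CommutativeRing c ℓ₁
  commutativeRing = HeytingCommutativeRing.commutativeRing heytingCommutativeRing

  open CommutativeRing commutativeRing public
    using (semiring; +-commutativeMonoid)
  open Mult semiring public using () renaming (_×_ to _·_)
  open Exp semiring public using (_^_)

  ι : ℕ → Carrier
  ι n = n · 1#

  field
    _<_                  : Rel Carrier ℓ₂
    isStrictPartialOrder : IsStrictPartialOrder _≈_ _<_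
    #⇒<⊎>                : ∀ {x y} → x # y → (x < y) ⊎ (y < x)
    <⊎>⇒#                : ∀ {x y} → (x < y) ⊎ (y < x) → x # y
    0<1                  : 0# < 1#
    +-monoˡ-<            : ∀ {x y} z → x < y → x + z < y + z
    *-pos                : ∀ {x y} → 0# < x → 0# < y → 0# < x * y
    archimedean          : ∀ x → ∃ λ n → x < ι n

  ∣_-_∣<_ : Carrier → Carrier → Carrier → Set ℓ₂
  ∣ x - y ∣< ε = (x + - y < ε) × (y + - x < ε)

  _⟶_ : (ℕ → Carrier) → Carrier → Set (c ⊔ ℓ₂)
  s ⟶ l = ∀ ε → 0# < ε → ∃ λ N → ∀ n → N ℕ.≤ n → ∣ s n - l ∣< ε

  Cauchy : (ℕ → Carrier) → Set (c ⊔ ℓ₂)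
  Cauchy s = ∀ ε → 0# < ε → ∃ λ N → ∀ m n → N ℕ.≤ m → N ℕ.≤ n → ∣ s m - s n ∣< ε

  field
    complete : ∀ s → Cauchy s → ∃ λ l → s ⟶ l

module RealDefs {c ℓ₁ ℓ₂ : Level} (R : RealField c ℓ₁ ℓ₂) where

  open RealField R
  open IsStrictPartialOrder isStrictPartialOrder
    using (<-respˡ-≈; <-respʳ-≈) renaming (trans to <-trans)

  ι-pos : ∀ n → 0# < ι (suc n)
  ι-pos zero    = <-respʳ-≈ (sym (+-identityʳ 1#)) 0<1
  ι-pos (suc n) = <-trans (ι-pos n)
    (<-respˡ-≈ (+-identityˡ (ι (suc n))) (+-monoˡ-< (ι (suc n)) 0<1))

  infixl 7 _÷_
  _÷_ : Carrier → (n : ℕ) .{{_ : NonZero n}} → Carrier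
  x ÷ suc n = x * proj₁ (#⇒invertible (<⊎>⇒# (inj₂ (ι-pos n))))

  infixl 7 _÷!_
  _÷!_ : Carrier → ℕ → Carrier
  x ÷! n = _÷_ x (n !) {{n !≢0}}

  -- ∑ n f = f 0 + f 1 + … + f (n - 1)
  ∑ : ℕ → (ℕ → Carrier) → Carrier
  ∑ n f = Sum.sum +-commutativeMonoid {n} (λ i → f (toℕ i))

  -- Formal power series in t: s n is the coefficient of tⁿ.
  Series : Set c
  Series = ℕ → Carrier

  oneₛ : Series
  oneₛ zero    = 1#
  oneₛ (suc _) = 0#

  infixl 6 _-ₛ_
  _-ₛ_ : Series → Series → Series
  (a -ₛ b) n = a n - b n

  infixl 7 _*ₛ_ _•ₛ_
  _*ₛ_ : Series → Series → Series
  (a *ₛ b) n = ∑ (suc n) (λ k → a k * b (n ∸ k))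

  _•ₛ_ : Carrier → Series → Series
  (x •ₛ a) n = x * a n

  _^ₛ_ : Series → ℕ → Series
  a ^ₛ zero  = oneₛ
  a ^ₛ suc k = a *ₛ (a ^ₛ k)

  -- exp(u) = Σₖ uᵏ / k!, for u with zero constant term; then uᵏ only has
  -- terms of degree ≥ k, so k ≤ n suffices for the coefficient of tⁿ.
  expₛ : Series → Series
  expₛ u n = ∑ (suc n) (λ k → (u ^ₛ k) n ÷! k)

  -- γ (γ - 1) ⋯ (γ - k + 1)
  falling : Carrier → ℕ → Carrier
  falling γ zero    = 1#
  falling γ (suc k) = falling γ k * (γ - ι k)

  -- (1 - t)^γ, by the binomial series
  [1-t]^_ : Carrier → Series
  ([1-t]^ γ) k = (- 1#) ^ k * (falling γ k ÷! k)

  -- The value at the real number x of the polynomial defined by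
  -- Σₙ Pₙ(x) tⁿ / n! = (1 - t)^α exp(x ((1 - t)^β - 1)).
  P : (α β : Carrier) → ℕ → Carrier → Carrier
  P α β n x =
    ι (n !) * (([1-t]^ α) *ₛ expₛ (x •ₛ (([1-t]^ β) -ₛ oneₛ))) n

  ℝ₊ : Set (c ⊔ ℓ₂)
  ℝ₊ = Σ Carrier (λ x → 0# < x)

  -- f′ x is the limit of (f y - f x) / (y - x) as y → x with y ≠ x, y > 0.
  IsDerivative : (f f′ : ℝ₊ → Carrier) → Set (c ⊔ ℓ₂)
  IsDerivative f f′ =
    ∀ (x : ℝ₊) ε → 0# < ε → ∃ λ δ → (0# < δ) ×
      (∀ (y : ℝ₊) (y#x : proj₁ y # proj₁ x) → ∣ proj₁ y - proj₁ x ∣< δ →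
        ∣ ((f y - f x) * proj₁ (#⇒invertible y#x)) - f′ x ∣< ε)

  -- g = (d/dx)ⁿ f on the positive half-line (f being n times differentiable).
  IsNthDerivative : ℕ → (f g : ℝ₊ → Carrier) → Set (c ⊔ ℓ₁ ⊔ ℓ₂)
  IsNthDerivative zero    f g = ∀ x → f x ≈ g x
  IsNthDerivative (suc n) f g = ∃ λ h → IsNthDerivative n f h × IsDerivative h g

  -- The real exponential function and the natural logarithm; both are
  -- uniquely determined by these specifications.
  record ExpLn : Set (c ⊔ ℓ₁ ⊔ ℓ₂) where
    field
      exp        : Carrier → Carrier
      exp-series : ∀ x → (λ n → ∑ n (λ k → x ^ k ÷! k)) ⟶ exp x
      ln         : ℝ₊ → Carrier
      exp-ln     : ∀ x → exp (ln x) ≈ proj₁ x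

    infixr 8 _^ᴿ_
    _^ᴿ_ : ℝ₊ → Carrier → Carrier
    x ^ᴿ γ = exp (γ * ln x)

{-# OPTIONS --safe #-}
-- Expanding the generating function gives P_n(y) = Σ_k c_{n,k} y^k / k!, where
-- c_{n,k} = n! [t^n] (1 - t)^α ((1 - t)^β - 1)^k is the k-th difference with step β,
-- at α, of γ ↦ (-1)^n γ (γ - 1) ⋯ (γ - n + 1).  The c_{n,k} satisfy the recurrence
-- c_{n+1,k} = (n - α - k β) c_{n,k} - k β c_{n,k-1}, which is also the one produced by
-- differentiating Σ_k (c_{n,k} / k!) x^(α - n + k β) e^(x^β) up to sign; this is the
-- first formula.  Since γ ↦ n - 1 - γ reflects γ (γ - 1) ⋯ (γ - n + 1) up to (-1)^n,
-- P_n^(α,β) = (-1)^n P_n^(n-1-α,-β), and the second formula is the first one for the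
-- parameters (n - 1 - α, - β).
--
-- On the analytic side, exp (x + y) = exp x exp y comes from the Cauchy product, and
-- 1 + x ≤ exp x for all real x then yields the derivatives of both exp and ln.
module Submission where

open import Defs
open import Algebra.Bundles using (CommutativeRing)
open import Algebra.Definitions using (Invertible)
open import Algebra.Solver.Ring.AlmostCommutativeRing using (fromCommutativeRing; _-Raw-AlmostCommutative⟶_)
open import Data.Empty using (⊥; ⊥-elim)
open import Data.Integer.Base as ℤ using (ℤ; +_; -[1+_])
open import Data.Maybe.Base using (Maybe; just; nothing)
open import Data.Nat.Base as ℕ using (ℕ; zero; suc; NonZero; _!; z≤n; s≤s; _∸_)
open import Data.Nat.Properties as ℕₚ using (_!≢0; m≤n⇒m≤1+n; ≤-refl; ≤-trans; m≤m+n; m≤n+m; n≤1+n)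
open import Data.Product.Base using (∃; _×_; _,_; proj₁; proj₂)
open import Data.Sum.Base using (_⊎_; inj₁; inj₂; [_,_]′)
open import Function.Base using (_∘_)
open import Relation.Binary.PropositionalEquality.Core as ≡ using ()
open import Relation.Binary.Structures using (IsStrictPartialOrder)
open import Relation.Nullary.Decidable.Core using (yes; no)
open import Relation.Nullary.Negation using (¬_)
import Algebra.Properties.AbelianGroup as AbelianGroupProperties
import Algebra.Properties.Ring as RingProperties
import Algebra.Properties.Semiring.Exp as Exp
import Algebra.Properties.Semiring.Mult as Mult
import Algebra.Properties.Semiring.Mult.TCOptimised as TCMult
import Algebra.Solver.Ring as RingSolver
import Data.Integer.Properties as ℤ
import Data.Sign.Base as Sign
import Relation.Binary.Reasoning.Setoid as SetoidReasoning

-- The undecidable order shapes the analysis. An inequality `x ≤ y` is the negation of `y < x`,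
-- hence provable by cases on signs that cannot be decided; absolute values become two-sided bounds,
-- and maxima and minima become sums and harmonic expressions. `exp` and `ln` are given by a series
-- and by `exp (ln x) ≈ proj₁ x` alone, with no congruence, continuity or monotonicity. Congruence
-- of `exp` comes from uniqueness of limits, and every estimate of `ln` from inequalities for `exp`.
-- Differentiability is carried as a remainder of size C h², which composes by plain algebra and is
-- turned into an ε-δ statement only once. On the formal side, (1 - t)^γ and exp (x t) are handled
-- through the first-order recurrences of their coefficients, so that no double sum of binomials has
-- to be rearranged.

-- A ring solver with integer coefficients.

module IntegerSolver {r₁ r₂} (R : CommutativeRing r₁ r₂) where

  open CommutativeRing R
  open RingProperties ring using (-0#≈0#; -‿distribˡ-*; -‿distribʳ-*; -‿involutive)
  open AbelianGroupProperties +-abelianGroup using (⁻¹-∙-comm)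
  open TCMult semiring using (1+×; ×-homo-+; ×1-homo-*) renaming (_×_ to _·′_)
  open SetoidReasoning setoid

  -- The optimised multiple sends 1 to `1#` by computation, so the solver constants `:0` and `:1`
  -- denote `0#` and `1#` exactly.
  fromℕ : ℕ → Carrier
  fromℕ n = n ·′ 1#

  fromℤ : ℤ → Carrier
  fromℤ (+ n)    = fromℕ n
  fromℤ -[1+ n ] = - fromℕ (suc n)

  fromℤ-⊖ : ∀ m n → fromℤ (m ℤ.⊖ n) ≈ fromℕ m - fromℕ n
  fromℤ-⊖ m       zero    = sym (trans (+-congˡ -0#≈0#) (+-identityʳ _))
  fromℤ-⊖ zero    (suc n) = sym (+-identityˡ _)
  fromℤ-⊖ (suc m) (suc n) = begin
    fromℤ (suc m ℤ.⊖ suc n)             ≡⟨ ≡.cong fromℤ (ℤ.[1+m]⊖[1+n]≡m⊖n m n) ⟩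
    fromℤ (m ℤ.⊖ n)                     ≈⟨ fromℤ-⊖ m n ⟩
    fromℕ m - fromℕ n                   ≈⟨ +-congʳ (+-identityʳ _) ⟨
    fromℕ m + 0# - fromℕ n              ≈⟨ +-congʳ (+-congˡ (-‿inverseʳ 1#)) ⟨
    fromℕ m + (1# - 1#) - fromℕ n       ≈⟨ +-congʳ (+-assoc _ _ _) ⟨
    fromℕ m + 1# - 1# - fromℕ n         ≈⟨ +-assoc _ _ _ ⟩
    fromℕ m + 1# + (- 1# - fromℕ n)     ≈⟨ +-cong (+-comm _ _) (⁻¹-∙-comm _ _) ⟩
    1# + fromℕ m - (1# + fromℕ n)       ≈⟨ +-cong (1+× m 1#) (-‿cong (1+× n 1#)) ⟨
    fromℕ (suc m) - fromℕ (suc n)       ∎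

  fromℤ-+ : ∀ i j → fromℤ (i ℤ.+ j) ≈ fromℤ i + fromℤ j
  fromℤ-+ (+ m)    (+ n)    = ×-homo-+ 1# m n
  fromℤ-+ (+ m)    -[1+ n ] = fromℤ-⊖ m (suc n)
  fromℤ-+ -[1+ m ] (+ n)    = trans (fromℤ-⊖ n (suc m)) (+-comm _ _)
  fromℤ-+ -[1+ m ] -[1+ n ] = begin
    - fromℕ (suc (suc (m ℕ.+ n)))       ≡⟨ ≡.cong (λ k → - fromℕ k) (≡.cong suc (ℕₚ.+-suc m n)) ⟨
    - fromℕ (suc m ℕ.+ suc n)           ≈⟨ -‿cong (×-homo-+ 1# (suc m) (suc n)) ⟩
    - (fromℕ (suc m) + fromℕ (suc n))   ≈⟨ ⁻¹-∙-comm _ _ ⟨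
    - fromℕ (suc m) - fromℕ (suc n)     ∎

  fromℤ-+◃ : ∀ n → fromℤ (Sign.+ ℤ.◃ n) ≈ fromℕ n
  fromℤ-+◃ zero    = refl
  fromℤ-+◃ (suc n) = refl

  fromℤ--◃ : ∀ n → fromℤ (Sign.- ℤ.◃ n) ≈ - fromℕ n
  fromℤ--◃ zero    = sym -0#≈0#
  fromℤ--◃ (suc n) = refl

  fromℤ-* : ∀ i j → fromℤ (i ℤ.* j) ≈ fromℤ i * fromℤ j
  fromℤ-* (+ m)    (+ n)    = trans (fromℤ-+◃ (m ℕ.* n)) (×1-homo-* m n)
  fromℤ-* (+ m)    -[1+ n ] = trans (fromℤ--◃ (m ℕ.* suc n))
    (trans (-‿cong (×1-homo-* m (suc n))) (-‿distribʳ-* _ _))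
  fromℤ-* -[1+ m ] (+ n)    = trans (fromℤ--◃ (suc m ℕ.* n))
    (trans (-‿cong (×1-homo-* (suc m) n)) (-‿distribˡ-* _ _))
  fromℤ-* -[1+ m ] -[1+ n ] = begin
    fromℤ (Sign.+ ℤ.◃ suc m ℕ.* suc n)  ≈⟨ fromℤ-+◃ (suc m ℕ.* suc n) ⟩
    fromℕ (suc m ℕ.* suc n)             ≈⟨ ×1-homo-* (suc m) (suc n) ⟩
    fromℕ (suc m) * fromℕ (suc n)       ≈⟨ -‿involutive _ ⟨
    - - (fromℕ (suc m) * fromℕ (suc n)) ≈⟨ -‿cong (-‿distribˡ-* _ _) ⟩
    - (- fromℕ (suc m) * fromℕ (suc n)) ≈⟨ -‿distribʳ-* _ _ ⟩
    - fromℕ (suc m) * - fromℕ (suc n)   ∎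

  fromℤ-neg : ∀ i → fromℤ (ℤ.- i) ≈ - fromℤ i
  fromℤ-neg (+ zero)  = sym -0#≈0#
  fromℤ-neg (+ suc n) = refl
  fromℤ-neg -[1+ n ]  = sym (-‿involutive _)

  morphism : ℤ.+-*-rawRing -Raw-AlmostCommutative⟶ fromCommutativeRing R
  morphism = record
    { ⟦_⟧    = fromℤ
    ; +-homo = fromℤ-+
    ; *-homo = fromℤ-*
    ; -‿homo = fromℤ-neg
    ; 0-homo = refl
    ; 1-homo = refl
    }

  fromℤ-≟ : ∀ i j → Maybe (fromℤ i ≈ fromℤ j)
  fromℤ-≟ i j with i ℤ.≟ j
  ... | yes ≡.refl = just refl
  ... | no  _      = nothing

  open RingSolver ℤ.+-*-rawRing (fromCommutativeRing R) morphism fromℤ-≟ public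
    using (Polynomial; solve; con; _:=_; _:+_; _:*_; _:-_; :-_)

  :0 :1 : ∀ {n} → Polynomial n
  :0 = con (+ 0)
  :1 = con (+ 1)

-- Order, two-sided bounds and arbitrarily small numbers.

module Order {c ℓ₁ ℓ₂} (R : RealField c ℓ₁ ℓ₂) where

  open RealField R hiding (zero)
  open RealDefs R
  open IntegerSolver commutativeRing
  open IsStrictPartialOrder isStrictPartialOrder
    using (<-respˡ-≈; <-respʳ-≈) renaming (trans to <-trans; irrefl to <-irrefl; asym to <-asym)

  x<y⇒0<y-x : ∀ {x y} → x < y → 0# < y - x
  x<y⇒0<y-x {x} x<y = <-respˡ-≈ (-‿inverseʳ x) (+-monoˡ-< (- x) x<y)

  0<y-x⇒x<y : ∀ {x y} → 0# < y - x → x < y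
  0<y-x⇒x<y {x} {y} 0<y-x = <-respˡ-≈ (+-identityˡ x)
    (<-respʳ-≈ (solve 2 (λ x y → y :- x :+ x := y) refl x y) (+-monoˡ-< x 0<y-x))

  x<0⇒0<-x : ∀ {x} → x < 0# → 0# < - x
  x<0⇒0<-x {x} x<0 = <-respʳ-≈ (+-identityˡ (- x)) (x<y⇒0<y-x x<0)

  0<-x⇒x<0 : ∀ {x} → 0# < - x → x < 0#
  0<-x⇒x<0 {x} 0<-x = 0<y-x⇒x<y (<-respʳ-≈ (sym (+-identityˡ (- x))) 0<-x)

  0<-resp : ∀ {x y} → x ≈ y → 0# < x → 0# < y
  0<-resp = <-respʳ-≈

  -- Cotransitivity of `#` yields an apartness; if its order is the wrong way round, transitivity
  -- with `x < y` supplies the other alternative.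
  <-cotrans : ∀ {x y} → x < y → ∀ z → x < z ⊎ z < y
  <-cotrans x<y z with #-cotrans (<⊎>⇒# (inj₁ x<y)) z
  ... | inj₁ x#z = [ inj₁ , (λ z<x → inj₂ (<-trans z<x x<y)) ]′ (#⇒<⊎> x#z)
  ... | inj₂ z#y = [ inj₂ , (λ y<z → inj₁ (<-trans x<y y<z)) ]′ (#⇒<⊎> z#y)

  -- x ≤ y is expressed as 0≤ y - x; being a negation, it may be proved by
  -- cases on the sign of any number.
  infix 4 0≤_
  0≤_ : Carrier → Set ℓ₂
  0≤ x = ¬ (x < 0#)

  0<⇒0≤ : ∀ {x} → 0# < x → 0≤ x
  0<⇒0≤ = <-asym

  0≤-resp : ∀ {x y} → x ≈ y → 0≤ x → 0≤ y
  0≤-resp x≈y 0≤x y<0 = 0≤x (<-respˡ-≈ (sym x≈y) y<0)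

  0≤-≈0 : ∀ {x} → x ≈ 0# → 0≤ x
  0≤-≈0 x≈0 = <-irrefl x≈0

  0≤1 : 0≤ 1#
  0≤1 = 0<⇒0≤ 0<1

  -- Tightness of `#`; equations obtained from estimates, such as uniqueness of limits, rest on it.
  sign-tight : ∀ {x} → ¬ (0# < x) → ¬ (x < 0#) → x ≈ 0#
  sign-tight ¬0<x ¬x<0 = proj₁ (tight _ _) (λ x#0 → [ ¬x<0 , ¬0<x ]′ (#⇒<⊎> x#0))

  0≤-antisym : ∀ {x} → 0≤ x → 0≤ (- x) → x ≈ 0#
  0≤-antisym {x} 0≤x 0≤-x = sign-tight
    (λ 0<x → 0≤-x (0<-x⇒x<0 (0<-resp (solve 1 (λ x → x := :- :- x) refl x) 0<x))) 0≤x

  -- The goal is a negation: once `y < 0#` is assumed, `pos` refutes `0# < x`, tightness gives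
  -- `x ≈ 0#`, and `null` refutes that.
  0≤-elim : ∀ {x y} → 0≤ x → (0# < x → 0≤ y) → (x ≈ 0# → 0≤ y) → 0≤ y
  0≤-elim 0≤x pos null y<0 = null (sign-tight (λ 0<x → pos 0<x y<0) 0≤x) y<0

  0<-+ : ∀ {x y} → 0# < x → 0# < y → 0# < x + y
  0<-+ {x} {y} 0<x 0<y = <-trans 0<y (<-respˡ-≈ (+-identityˡ y) (+-monoˡ-< y 0<x))

  -- A strict conclusion does not admit cases on the sign of y. Cotransitivity at `x + y` decides
  -- instead, its second branch forcing `y < 0#`.
  0<-+-0≤ : ∀ {x y} → 0# < x → 0≤ y → 0# < x + y
  0<-+-0≤ {x} {y} 0<x 0≤y with <-cotrans 0<x (x + y)
  ... | inj₁ 0<x+y = 0<x+y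
  ... | inj₂ x+y<x = ⊥-elim (0≤y (0<-x⇒x<0
    (0<-resp (solve 2 (λ x y → x :- (x :+ y) := :- y) refl x y) (x<y⇒0<y-x x+y<x))))

  0≤-+ : ∀ {x y} → 0≤ x → 0≤ y → 0≤ x + y
  0≤-+ {x} {y} 0≤x 0≤y = 0≤-elim 0≤x
    (λ 0<x → 0<⇒0≤ (0<-+-0≤ 0<x 0≤y))
    (λ x≈0 → 0≤-resp (trans (sym (+-identityˡ y)) (+-congʳ (sym x≈0))) 0≤y)

  0≤-* : ∀ {x y} → 0≤ x → 0≤ y → 0≤ x * y
  0≤-* {x} {y} 0≤x 0≤y = 0≤-elim 0≤x
    (λ 0<x → 0≤-elim 0≤y
      (λ 0<y → 0<⇒0≤ (*-pos 0<x 0<y))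
      (λ y≈0 → 0≤-≈0 (trans (*-congˡ y≈0) (zeroʳ x))))
    (λ x≈0 → 0≤-≈0 (trans (*-congʳ x≈0) (zeroˡ y)))

  0≤-sq : ∀ x → 0≤ x * x
  0≤-sq x x²<0 = 0≤-* 0≤x 0≤x x²<0
    where
    0≤x : 0≤ x
    0≤x x<0 = 0<⇒0≤ (0<-resp (solve 1 (λ x → :- x :* :- x := x :* x) refl x)
      (*-pos (x<0⇒0<-x x<0) (x<0⇒0<-x x<0))) x²<0

  opaque
    -- An inverse is itself invertible, hence apart from 0 and of definite sign; a negative one
    -- would make -1 positive. What `#` inverts is the difference `x - 0#`, whence the terms with
    -- `:0`.
    recip : ∀ {x} → 0# < x → ∃ λ w → (0# < w) × (x * w ≈ 1#)
    recip {x} 0<x with #⇒invertible (<⊎>⇒# (inj₂ 0<x))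
    ... | w , wx≈1 , xw≈1 = w , [ (λ w<0 → ⊥-elim (-1≮0 w<0)) , (λ 0<w → 0<w) ]′ (#⇒<⊎> w#0) , xw≈1′
      where
      xw≈1′ : x * w ≈ 1#
      xw≈1′ = trans (solve 2 (λ x w → x :* w := (x :- :0) :* w) refl x w) xw≈1
      w#0 : w # 0#
      w#0 = invertible⇒# (x ,
        trans (solve 2 (λ x w → x :* (w :- :0) := x :* w) refl x w) xw≈1′ ,
        trans (solve 2 (λ x w → (w :- :0) :* x := x :* w) refl x w) xw≈1′)
      -1≮0 : w < 0# → ⊥
      -1≮0 w<0 = <-asym 0<1 (0<-x⇒x<0 (0<-resp
        (trans (solve 2 (λ x w → x :* :- w := :- (x :* w)) refl x w) (-‿cong xw≈1′))
        (*-pos 0<x (x<0⇒0<-x w<0))))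

  0≤-cancelˡ : ∀ {x y} → 0# < x → 0≤ x * y → 0≤ y
  0≤-cancelˡ {x} {y} 0<x 0≤xy with recip 0<x
  ... | w , 0<w , xw≈1 = 0≤-resp
    (trans (solve 3 (λ x y w → w :* (x :* y) := x :* w :* y) refl x y w)
      (trans (*-congʳ xw≈1) (*-identityˡ y)))
    (0≤-* (0<⇒0≤ 0<w) 0≤xy)

  0≤-double⁻ : ∀ {x} → 0≤ x + x → 0≤ x
  0≤-double⁻ 0≤2x x<0 = 0≤2x (0<-x⇒x<0
    (0<-resp (solve 1 (λ x → :- x :+ :- x := :- (x :+ x)) refl _)
      (0<-+ (x<0⇒0<-x x<0) (x<0⇒0<-x x<0))))

  -- a b / (a + b) stands in for the minimum of a and b.
  opaque
    lowerBound : ∀ {a b} → 0# < a → 0# < b → ∃ λ d → (0# < d) × (0≤ a - d) × (0≤ b - d)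
    lowerBound {a} {b} 0<a 0<b with recip (0<-+ 0<a 0<b)
    ... | w , 0<w , [a+b]w≈1 = a * b * w , *-pos (*-pos 0<a 0<b) 0<w ,
      0≤-resp (trans (solve 3 (λ a b w → a :* a :* w := a :* ((a :+ b) :* w) :- a :* b :* w) refl a b w)
        (+-congʳ (trans (*-congˡ [a+b]w≈1) (*-identityʳ a))))
        (0<⇒0≤ (*-pos (*-pos 0<a 0<a) 0<w)) ,
      0≤-resp (trans (solve 3 (λ a b w → b :* b :* w := b :* ((a :+ b) :* w) :- a :* b :* w) refl a b w)
        (+-congʳ (trans (*-congˡ [a+b]w≈1) (*-identityʳ b))))
        (0<⇒0≤ (*-pos (*-pos 0<b 0<b) 0<w))

  -- x ≼ m says ∣x∣ ≤ m.
  infix 4 _≼_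
  _≼_ : Carrier → Carrier → Set ℓ₂
  x ≼ m = (0≤ m - x) × (0≤ m + x)

  ≼-resp : ∀ {x y m n} → x ≈ y → m ≈ n → x ≼ m → y ≼ n
  ≼-resp x≈y m≈n (m-x , m+x) = 0≤-resp (+-cong m≈n (-‿cong x≈y)) m-x , 0≤-resp (+-cong m≈n x≈y) m+x

  0≤⇒≼ : ∀ {m} → 0≤ m → m ≼ m
  0≤⇒≼ {m} 0≤m = 0≤-≈0 (-‿inverseʳ m) , 0≤-+ 0≤m 0≤m

  ≼⇒0≤ : ∀ {x m} → x ≼ m → 0≤ m
  ≼⇒0≤ {x} {m} (m-x , m+x) =
    0≤-double⁻ (0≤-resp (solve 2 (λ m x → m :- x :+ (m :+ x) := m :+ m) refl m x) (0≤-+ m-x m+x))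

  ≼-weaken : ∀ {x m n} → x ≼ m → 0≤ n - m → x ≼ n
  ≼-weaken {x} {m} {n} (m-x , m+x) n-m =
    0≤-resp (solve 3 (λ x m n → m :- x :+ (n :- m) := n :- x) refl x m n) (0≤-+ m-x n-m) ,
    0≤-resp (solve 3 (λ x m n → m :+ x :+ (n :- m) := n :+ x) refl x m n) (0≤-+ m+x n-m)

  ≼-+ : ∀ {x y m n} → x ≼ m → y ≼ n → x + y ≼ m + n
  ≼-+ {x} {y} {m} {n} (m-x , m+x) (n-y , n+y) =
    0≤-resp (solve 4 (λ x y m n → m :- x :+ (n :- y) := m :+ n :- (x :+ y)) refl x y m n) (0≤-+ m-x n-y) ,
    0≤-resp (solve 4 (λ x y m n → m :+ x :+ (n :+ y) := m :+ n :+ (x :+ y)) refl x y m n) (0≤-+ m+x n+y)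

  -- Twice each required difference is a sum of two products of nonnegative factors, so no signs
  -- have to be distinguished.
  ≼-* : ∀ {x y m n} → x ≼ m → y ≼ n → x * y ≼ m * n
  ≼-* {x} {y} {m} {n} (m-x , m+x) (n-y , n+y) =
    0≤-double⁻ (0≤-resp
      (solve 4 (λ x y m n → (m :- x) :* (n :+ y) :+ (m :+ x) :* (n :- y)
        := m :* n :- x :* y :+ (m :* n :- x :* y)) refl x y m n)
      (0≤-+ (0≤-* m-x n+y) (0≤-* m+x n-y))) ,
    0≤-double⁻ (0≤-resp
      (solve 4 (λ x y m n → (m :- x) :* (n :- y) :+ (m :+ x) :* (n :+ y)
        := m :* n :+ x :* y :+ (m :* n :+ x :* y)) refl x y m n)
      (0≤-+ (0≤-* m-x n-y) (0≤-* m+x n+y)))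

  0≤-ι : ∀ n → 0≤ ι n
  0≤-ι zero    = 0≤-≈0 refl
  0≤-ι (suc n) = 0<⇒0≤ (ι-pos n)

  opaque
    -- The Archimedean bounds of x and - x are added in place of a maximum; the extra 1 makes the
    -- bound positive, hence invertible.
    bounded : ∀ x → ∃ λ m → (0# < m) × (x ≼ m)
    bounded x with archimedean x | archimedean (- x)
    ... | p , x<p | q , -x<q = ι p + ι q + 1# ,
      0<-resp (+-comm _ _) (0<-+-0≤ 0<1 (0≤-+ (0≤-ι p) (0≤-ι q))) ,
      0≤-resp (solve 3 (λ x p q → p :- x :+ (q :+ :1) := p :+ q :+ :1 :- x) refl x (ι p) (ι q))
        (0≤-+ (0<⇒0≤ (x<y⇒0<y-x x<p)) (0≤-+ (0≤-ι q) 0≤1)) ,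
      0≤-resp (solve 3 (λ x p q → q :- :- x :+ (p :+ :1) := p :+ q :+ :1 :+ x) refl x (ι p) (ι q))
        (0≤-+ (0<⇒0≤ (x<y⇒0<y-x -x<q)) (0≤-+ (0≤-ι p) 0≤1))

  ∣-∣<⇒≼ : ∀ {x y ε} → ∣ x - y ∣< ε → x - y ≼ ε
  ∣-∣<⇒≼ {x} {y} {ε} (x-y<ε , y-x<ε) = 0<⇒0≤ (x<y⇒0<y-x x-y<ε) ,
    0≤-resp (solve 3 (λ x y ε → ε :- (y :- x) := ε :+ (x :- y)) refl x y ε) (0<⇒0≤ (x<y⇒0<y-x y-x<ε))

  ≼⇒∣-∣< : ∀ {x y m ε} → x - y ≼ m → m < ε → ∣ x - y ∣< ε
  ≼⇒∣-∣< {x} {y} {m} {ε} (p , q) m<ε =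
    0<y-x⇒x<y (0<-resp (solve 4 (λ x y m ε → ε :- m :+ (m :- (x :- y)) := ε :- (x :- y)) refl x y m ε)
      (0<-+-0≤ (x<y⇒0<y-x m<ε) p)) ,
    0<y-x⇒x<y (0<-resp (solve 4 (λ x y m ε → ε :- m :+ (m :+ (x :- y)) := ε :- (y :- x)) refl x y m ε)
      (0<-+-0≤ (x<y⇒0<y-x m<ε) q))

  ½ : Carrier
  ½ = proj₁ (recip (0<-+ 0<1 0<1))

  0<½ : 0# < ½
  0<½ = proj₁ (proj₂ (recip (0<-+ 0<1 0<1)))

  ½+½≈1 : ½ + ½ ≈ 1#
  ½+½≈1 = trans (solve 1 (λ h → h :+ h := (:1 :+ :1) :* h) refl ½) (proj₂ (proj₂ (recip (0<-+ 0<1 0<1))))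

  -- Testing at ε = ½ x / C would give x ≤ ½ x for x > 0.
  0≤-small : ∀ {x C} → 0# < C → (∀ ε → 0# < ε → 0≤ C * ε - x) → 0≤ (- x)
  0≤-small {x} {C} 0<C small -x<0 with recip 0<C
  ... | w , 0<w , Cw≈1 = small (½ * x * w) (*-pos (*-pos 0<½ 0<x) 0<w)
    (0<-x⇒x<0 (0<-resp eq (*-pos 0<½ 0<x)))
    where
    0<x : 0# < x
    0<x = 0<-resp (solve 1 (λ x → :- :- x := x) refl x) (x<0⇒0<-x -x<0)
    eq : ½ * x ≈ - (C * (½ * x * w) - x)
    eq = trans (solve 2 (λ h x → h :* x := (h :+ h) :* x :- h :* x) refl ½ x)
      (trans (+-cong (trans (*-congʳ ½+½≈1) (*-identityˡ x))
          (-‿cong (trans (sym (*-identityˡ _)) (*-congʳ (sym Cw≈1)))))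
        (solve 4 (λ C h x w → x :- C :* w :* (h :* x) := :- (C :* (h :* x :* w) :- x)) refl C ½ x w))

  ≼-small : ∀ {x C} → 0# < C → (∀ ε → 0# < ε → x ≼ C * ε) → x ≈ 0#
  ≼-small {x} 0<C small = 0≤-antisym
    (0≤-resp (solve 1 (λ x → :- :- x := x) refl x)
      (0≤-small 0<C (λ ε 0<ε → 0≤-resp (+-congˡ (solve 1 (λ x → x := :- :- x) refl x)) (proj₂ (small ε 0<ε)))))
    (0≤-small 0<C (λ ε 0<ε → proj₁ (small ε 0<ε)))

-- Finite sums and formal power series.

module PowerSeries {c ℓ₁ ℓ₂} (R : RealField c ℓ₁ ℓ₂) where

  open RealField R hiding (zero)
  open RealDefs R
  open IntegerSolver commutativeRing
  open Mult semiring using (×1-homo-*)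
  open SetoidReasoning (CommutativeRing.setoid commutativeRing)

  ι-invertible : ∀ m .{{_ : NonZero m}} x → ι m * (x ÷ m) ≈ x
  ι-invertible (suc n) x with #⇒invertible (<⊎>⇒# (inj₂ (ι-pos n)))
  ... | w , _ , [m-0]w≈1 = begin
    ι (suc n) * (x * w)          ≈⟨ solve 3 (λ m x w → m :* (x :* w) := (m :- :0) :* w :* x) refl (ι (suc n)) x w ⟩
    (ι (suc n) - 0#) * w * x     ≈⟨ *-congʳ [m-0]w≈1 ⟩
    1# * x                       ≈⟨ *-identityˡ x ⟩
    x                            ∎

  ι-cancelˡ : ∀ m .{{_ : NonZero m}} {x y} → ι m * x ≈ ι m * y → x ≈ y
  ι-cancelˡ m {x} {y} mx≈my = begin
    x                       ≈⟨ *-identityˡ x ⟨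
    1# * x                  ≈⟨ *-congʳ (ι-invertible m 1#) ⟨
    ι m * (1# ÷ m) * x      ≈⟨ solve 3 (λ m w x → m :* w :* x := w :* (m :* x)) refl (ι m) (1# ÷ m) x ⟩
    (1# ÷ m) * (ι m * x)    ≈⟨ *-congˡ mx≈my ⟩
    (1# ÷ m) * (ι m * y)    ≈⟨ solve 3 (λ m w x → w :* (m :* x) := m :* w :* x) refl (ι m) (1# ÷ m) y ⟩
    ι m * (1# ÷ m) * y      ≈⟨ *-congʳ (ι-invertible m 1#) ⟩
    1# * y                  ≈⟨ *-identityˡ y ⟩
    y                       ∎

  !-*-÷! : ∀ n x → ι (n !) * (x ÷! n) ≈ x
  !-*-÷! n = ι-invertible (n !) {{n !≢0}}

  !-cancelˡ : ∀ n {x y} → ι (n !) * x ≈ ι (n !) * y → x ≈ y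
  !-cancelˡ n = ι-cancelˡ (n !) {{n !≢0}}

  ÷!-≈-* : ∀ n x → x ÷! n ≈ x * (1# ÷! n)
  ÷!-≈-* n x = !-cancelˡ n (begin
    ι (n !) * (x ÷! n)            ≈⟨ !-*-÷! n x ⟩
    x                             ≈⟨ *-identityʳ x ⟨
    x * 1#                        ≈⟨ *-congˡ (!-*-÷! n 1#) ⟨
    x * (ι (n !) * (1# ÷! n))     ≈⟨ solve 3 (λ m w x → x :* (m :* w) := m :* (x :* w)) refl (ι (n !)) (1# ÷! n) x ⟩
    ι (n !) * (x * (1# ÷! n))     ∎)

  ÷!-suc : ∀ n x → ι (suc n) * (x ÷! suc n) ≈ x ÷! n
  ÷!-suc n x = !-cancelˡ n (begin
    ι (n !) * (ι (suc n) * (x ÷! suc n))   ≈⟨ solve 3 (λ a b c → a :* (b :* c) := b :* a :* c)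
         refl (ι (n !)) (ι (suc n)) (x ÷! suc n) ⟩
    ι (suc n) * ι (n !) * (x ÷! suc n)     ≈⟨ *-congʳ (×1-homo-* (suc n) (n !)) ⟨
    ι (suc n !) * (x ÷! suc n)             ≈⟨ !-*-÷! (suc n) x ⟩
    x                                      ≈⟨ !-*-÷! n x ⟨
    ι (n !) * (x ÷! n)                     ∎)

  ∑-cong : ∀ n {f g : ℕ → Carrier} → (∀ k → f k ≈ g k) → ∑ n f ≈ ∑ n g
  ∑-cong zero    f≈g = refl
  ∑-cong (suc n) f≈g = +-cong (f≈g 0) (∑-cong n (f≈g ∘ suc))

  ∑-zero : ∀ n {f : ℕ → Carrier} → (∀ k → f k ≈ 0#) → ∑ n f ≈ 0#
  ∑-zero zero    f≈0 = refl
  ∑-zero (suc n) f≈0 = trans (+-cong (f≈0 0) (∑-zero n (f≈0 ∘ suc))) (+-identityˡ 0#)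

  ∑-linear : ∀ n p q (f g : ℕ → Carrier) →
    ∑ n (λ k → p * f k + q * g k) ≈ p * ∑ n f + q * ∑ n g
  ∑-linear zero    p q f g = solve 2 (λ p q → :0 := p :* :0 :+ q :* :0) refl p q
  ∑-linear (suc n) p q f g = trans (+-congˡ (∑-linear n p q (f ∘ suc) (g ∘ suc)))
    (solve 6 (λ p q f₀ g₀ f₁ g₁ → p :* f₀ :+ q :* g₀ :+ (p :* f₁ :+ q :* g₁)
      := p :* (f₀ :+ f₁) :+ q :* (g₀ :+ g₁)) refl p q (f 0) (g 0) (∑ n (f ∘ suc)) (∑ n (g ∘ suc)))

  ∑-scale : ∀ n p (f : ℕ → Carrier) → ∑ n (λ k → p * f k) ≈ p * ∑ n f
  ∑-scale zero    p f = sym (zeroʳ p)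
  ∑-scale (suc n) p f = trans (+-congˡ (∑-scale n p (f ∘ suc))) (sym (distribˡ p _ _))

  ∑-last : ∀ n (f : ℕ → Carrier) → ∑ (suc n) f ≈ ∑ n f + f n
  ∑-last zero    f = +-comm (f 0) 0#
  ∑-last (suc n) f = trans (+-congˡ (∑-last n (f ∘ suc))) (sym (+-assoc _ _ _))

  ∑-extend : ∀ {m n} (f : ℕ → Carrier) → m ℕ.≤ n → (∀ k → m ℕ.≤ k → f k ≈ 0#) → ∑ m f ≈ ∑ n f
  ∑-extend {n = n} f z≤n       f≈0 = sym (∑-zero n (λ k → f≈0 k z≤n))
  ∑-extend         f (s≤s m≤n) f≈0 = +-congˡ (∑-extend (f ∘ suc) m≤n (λ k m≤k → f≈0 (suc k) (s≤s m≤k)))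

  -- By computation, the coefficient of degree `suc n` is `a 0 * b (suc n)` plus that of degree n of
  -- `(a ∘ suc) *ₛ b`; the inductions on the degree below peel off this term. The restriction
  -- `k ≤ n` matters for `expₛ`, whose truncation varies with the degree.
  *ₛ-congˡ-≤ : ∀ n (a b b′ : Series) → (∀ k → k ℕ.≤ n → b k ≈ b′ k) → (a *ₛ b) n ≈ (a *ₛ b′) n
  *ₛ-congˡ-≤ zero    a b b′ b≈b′ = +-congʳ (*-congˡ (b≈b′ 0 z≤n))
  *ₛ-congˡ-≤ (suc n) a b b′ b≈b′ = +-cong (*-congˡ (b≈b′ (suc n) ≤-refl))
    (*ₛ-congˡ-≤ n (a ∘ suc) b b′ (λ k k≤n → b≈b′ k (m≤n⇒m≤1+n k≤n)))

  *ₛ-congˡ : ∀ n (a b b′ : Series) → (∀ k → b k ≈ b′ k) → (a *ₛ b) n ≈ (a *ₛ b′) n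
  *ₛ-congˡ n a b b′ b≈b′ = *ₛ-congˡ-≤ n a b b′ (λ k _ → b≈b′ k)

  *ₛ-congʳ : ∀ n (a a′ b : Series) → (∀ k → a k ≈ a′ k) → (a *ₛ b) n ≈ (a′ *ₛ b) n
  *ₛ-congʳ zero    a a′ b a≈a′ = +-congʳ (*-congʳ (a≈a′ 0))
  *ₛ-congʳ (suc n) a a′ b a≈a′ = +-cong (*-congʳ (a≈a′ 0)) (*ₛ-congʳ n (a ∘ suc) (a′ ∘ suc) b (a≈a′ ∘ suc))

  *ₛ-linearˡ : ∀ n p q (a b d : Series) →
    ((λ k → p * a k + q * b k) *ₛ d) n ≈ p * (a *ₛ d) n + q * (b *ₛ d) n
  *ₛ-linearˡ zero    p q a b d = solve 5
    (λ p q a b d → (p :* a :+ q :* b) :* d :+ :0 := p :* (a :* d :+ :0) :+ q :* (b :* d :+ :0))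
    refl p q (a 0) (b 0) (d 0)
  *ₛ-linearˡ (suc n) p q a b d = trans (+-congˡ (*ₛ-linearˡ n p q (a ∘ suc) (b ∘ suc) d))
    (solve 7 (λ p q a b d a′ b′ → (p :* a :+ q :* b) :* d :+ (p :* a′ :+ q :* b′)
      := p :* (a :* d :+ a′) :+ q :* (b :* d :+ b′))
    refl p q (a 0) (b 0) (d (suc n)) (((a ∘ suc) *ₛ d) n) (((b ∘ suc) *ₛ d) n))

  *ₛ-linearʳ : ∀ n p q (a b d : Series) →
    (a *ₛ (λ k → p * b k + q * d k)) n ≈ p * (a *ₛ b) n + q * (a *ₛ d) n
  *ₛ-linearʳ zero    p q a b d = solve 5
    (λ p q a b d → a :* (p :* b :+ q :* d) :+ :0 := p :* (a :* b :+ :0) :+ q :* (a :* d :+ :0))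
    refl p q (a 0) (b 0) (d 0)
  *ₛ-linearʳ (suc n) p q a b d = trans (+-congˡ (*ₛ-linearʳ n p q (a ∘ suc) b d))
    (solve 7 (λ p q a b d b′ d′ → a :* (p :* b :+ q :* d) :+ (p :* b′ :+ q :* d′)
      := p :* (a :* b :+ b′) :+ q :* (a :* d :+ d′))
    refl p q (a 0) (b (suc n)) (d (suc n)) (((a ∘ suc) *ₛ b) n) (((a ∘ suc) *ₛ d) n))

  *ₛ-zeroʳ : ∀ n (a : Series) → (a *ₛ (λ _ → 0#)) n ≈ 0#
  *ₛ-zeroʳ n a = ∑-zero (suc n) (λ k → zeroʳ (a k))

  *ₛ-scaleʳ : ∀ n p (a b : Series) → (a *ₛ (λ k → p * b k)) n ≈ p * (a *ₛ b) n
  *ₛ-scaleʳ n p a b = trans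
    (*ₛ-congˡ n a _ (λ k → p * b k + 0# * b k) (λ k → solve 2 (λ p b → p :* b := p :* b :+ :0 :* b) refl p (b k)))
    (trans (*ₛ-linearʳ n p 0# a b b)
      (solve 2 (λ p s → p :* s :+ :0 :* s := p :* s) refl p ((a *ₛ b) n)))

  *ₛ-identityʳ : ∀ n (a : Series) → (a *ₛ oneₛ) n ≈ a n
  *ₛ-identityʳ zero    a = solve 1 (λ a → a :* :1 :+ :0 := a) refl (a 0)
  *ₛ-identityʳ (suc n) a = trans (+-cong (zeroʳ (a 0)) (*ₛ-identityʳ n (a ∘ suc))) (+-identityˡ _)

  *ₛ-assoc : ∀ n (a b d : Series) → ((a *ₛ b) *ₛ d) n ≈ (a *ₛ (b *ₛ d)) n
  *ₛ-assoc zero    a b d = solve 3 (λ a b d → (a :* b :+ :0) :* d :+ :0 := a :* (b :* d :+ :0) :+ :0)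
       refl (a 0) (b 0) (d 0)
  *ₛ-assoc (suc n) a b d = begin
    (a 0 * b 0 + 0#) * d (suc n) + (((a *ₛ b) ∘ suc) *ₛ d) n
      ≈⟨ +-congˡ (*ₛ-congʳ n _ (λ k → a 0 * b (suc k) + 1# * ((a ∘ suc) *ₛ b) k) d (λ k → +-congˡ (sym (*-identityˡ _)))) ⟩
    (a 0 * b 0 + 0#) * d (suc n) + ((λ k → a 0 * b (suc k) + 1# * ((a ∘ suc) *ₛ b) k) *ₛ d) n
      ≈⟨ +-congˡ (*ₛ-linearˡ n (a 0) 1# (b ∘ suc) ((a ∘ suc) *ₛ b) d) ⟩
    (a 0 * b 0 + 0#) * d (suc n) + (a 0 * ((b ∘ suc) *ₛ d) n + 1# * (((a ∘ suc) *ₛ b) *ₛ d) n)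
      ≈⟨ +-congˡ (+-congˡ (*-congˡ (*ₛ-assoc n (a ∘ suc) b d))) ⟩
    (a 0 * b 0 + 0#) * d (suc n) + (a 0 * ((b ∘ suc) *ₛ d) n + 1# * ((a ∘ suc) *ₛ (b *ₛ d)) n)
      ≈⟨ solve 5 (λ a b d s t → (a :* b :+ :0) :* d :+ (a :* s :+ :1 :* t) := a :* (b :* d :+ s) :+ t)
           refl (a 0) (b 0) (d (suc n)) (((b ∘ suc) *ₛ d) n) (((a ∘ suc) *ₛ (b *ₛ d)) n) ⟩
    a 0 * (b 0 * d (suc n) + ((b ∘ suc) *ₛ d) n) + ((a ∘ suc) *ₛ (b *ₛ d)) n ∎

  *ₛ-shiftʳ : ∀ n (a b : Series) → b 0 ≈ 0# → (a *ₛ b) (suc n) ≈ (a *ₛ (b ∘ suc)) n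
  *ₛ-shiftʳ zero    a b b₀≈0 = +-congˡ (trans (+-identityʳ _) (trans (*-congˡ b₀≈0) (zeroʳ _)))
  *ₛ-shiftʳ (suc n) a b b₀≈0 = +-congˡ (*ₛ-shiftʳ n (a ∘ suc) b b₀≈0)

  *ₛ-∑ : ∀ N n (a : Series) (g : ℕ → Series) →
    (a *ₛ (λ j → ∑ N (λ k → g k j))) n ≈ ∑ N (λ k → (a *ₛ g k) n)
  *ₛ-∑ zero    n a g = *ₛ-zeroʳ n a
  *ₛ-∑ (suc N) n a g = begin
    (a *ₛ (λ j → g 0 j + ∑ N (λ k → g (suc k) j))) n
      ≈⟨ *ₛ-congˡ n a _ (λ j → 1# * g 0 j + 1# * ∑ N (λ k → g (suc k) j)) (λ _ → +-cong (sym (*-identityˡ _)) (sym (*-identityˡ _))) ⟩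
    (a *ₛ (λ j → 1# * g 0 j + 1# * ∑ N (λ k → g (suc k) j))) n
      ≈⟨ *ₛ-linearʳ n 1# 1# a (g 0) (λ j → ∑ N (λ k → g (suc k) j)) ⟩
    1# * (a *ₛ g 0) n + 1# * (a *ₛ (λ j → ∑ N (λ k → g (suc k) j))) n
      ≈⟨ +-cong (*-identityˡ _) (trans (*-identityˡ _) (*ₛ-∑ N n a (g ∘ suc))) ⟩
    (a *ₛ g 0) n + ∑ N (λ k → (a *ₛ g (suc k)) n) ∎

  -- The Euler operator t d/dt, a derivation that preserves degrees.
  θ : Series → Series
  θ a n = ι n * a n

  θ-leibniz : ∀ n (a b : Series) → θ (a *ₛ b) n ≈ (θ a *ₛ b) n + (a *ₛ θ b) n
  θ-leibniz zero    a b = solve 2 (λ a b → :0 :* (a :* b :+ :0) := :0 :* a :* b :+ :0 :+ (a :* (:0 :* b) :+ :0))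
       refl (a 0) (b 0)
  θ-leibniz (suc n) a b = begin
    (1# + ι n) * (a 0 * b (suc n) + (a′ *ₛ b) n)
      ≈⟨ solve 4 (λ i a b s → (:1 :+ i) :* (a :* b :+ s) := a :* ((:1 :+ i) :* b) :+ (s :+ i :* s))
           refl (ι n) (a 0) (b (suc n)) ((a′ *ₛ b) n) ⟩
    a 0 * θ b (suc n) + ((a′ *ₛ b) n + θ (a′ *ₛ b) n)
      ≈⟨ +-congˡ (+-congˡ (θ-leibniz n a′ b)) ⟩
    a 0 * θ b (suc n) + ((a′ *ₛ b) n + ((θ a′ *ₛ b) n + (a′ *ₛ θ b) n))
      ≈⟨ solve 5 (λ x s t u z → x :+ (s :+ (t :+ u)) := z :* :0 :+ (:1 :* s :+ :1 :* t) :+ (x :+ u))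
           refl _ _ _ _ (a 0 * b (suc n)) ⟩
    -- The null term is to become the leading term of `θ a *ₛ b`, since `θ a 0` is `0# * a 0`.
    (a 0 * b (suc n)) * 0# + (1# * (a′ *ₛ b) n + 1# * (θ a′ *ₛ b) n) + (a 0 * θ b (suc n) + (a′ *ₛ θ b) n)
      ≈⟨ +-congʳ (+-congˡ (*ₛ-linearˡ n 1# 1# a′ (θ a′) b)) ⟨
    (a 0 * b (suc n)) * 0# + ((λ k → 1# * a′ k + 1# * θ a′ k) *ₛ b) n + (a 0 * θ b (suc n) + (a′ *ₛ θ b) n)
      ≈⟨ +-congʳ (+-cong (solve 2 (λ a b → a :* b :* :0 := :0 :* a :* b) refl (a 0) (b (suc n)))
           (*ₛ-congʳ n (λ k → 1# * a′ k + 1# * θ a′ k) (θ a ∘ suc) b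
             (λ k → solve 2 (λ i a → :1 :* a :+ :1 :* (i :* a) := (:1 :+ i) :* a) refl (ι k) (a′ k)))) ⟩
    (θ a *ₛ b) (suc n) + (a *ₛ θ b) (suc n) ∎
    where
    a′ : Series
    a′ = a ∘ suc

  -- The coefficientwise form of the differential equation s′ = p t s′ + x s,
  -- which is solved by exp (x t) for p = 0 and by (1 - t)^(- x) for p = 1.
  Solves : Carrier → Carrier → Series → Set ℓ₁
  Solves p x s = ∀ n → ι (suc n) * s (suc n) ≈ (p * ι n + x) * s n

  Solves-unique : ∀ {p x s t} → s 0 ≈ t 0 → Solves p x s → Solves p x t → ∀ n → s n ≈ t n
  Solves-unique s₀≈t₀ S T zero    = s₀≈t₀
  Solves-unique s₀≈t₀ S T (suc n) = ι-cancelˡ (suc n)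
    (trans (S n) (trans (*-congˡ (Solves-unique s₀≈t₀ S T n)) (sym (T n))))

  -- The product rule for s′ = p t s′ + x s: for a common p the rates x and y add. The addition laws
  -- of exp (x t) and of (1 - t)^γ are both instances.
  Solves-* : ∀ {p x y a b} → Solves p x a → Solves p y b → Solves p (x + y) (a *ₛ b)
  Solves-* {p} {x} {y} {a} {b} A B n = begin
    θ (a *ₛ b) (suc n)
      ≈⟨ θ-leibniz (suc n) a b ⟩
    (0# * a 0 * b (suc n) + ((θ a ∘ suc) *ₛ b) n) + (a *ₛ θ b) (suc n)
      ≈⟨ +-cong (+-cong (solve 2 (λ a b → :0 :* a :* b := :0) refl (a 0) (b (suc n)))
           (trans (*ₛ-congʳ n (θ a ∘ suc) (λ k → p * θ a k + x * a k) b (λ k → trans (A k) (expand x (ι k) (a k)))) (*ₛ-linearˡ n p x (θ a) a b)))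
         (trans (*ₛ-shiftʳ n a (θ b) (zeroˡ _))
           (trans (*ₛ-congˡ n a (θ b ∘ suc) (λ k → p * θ b k + y * b k) (λ k → trans (B k) (expand y (ι k) (b k)))) (*ₛ-linearʳ n p y a (θ b) b))) ⟩
    (0# + (p * (θ a *ₛ b) n + x * (a *ₛ b) n)) + (p * (a *ₛ θ b) n + y * (a *ₛ b) n)
      ≈⟨ solve 6 (λ p x y s t u → :0 :+ (p :* s :+ x :* t) :+ (p :* u :+ y :* t) := p :* (s :+ u) :+ (x :+ y) :* t)
           refl p x y _ _ _ ⟩
    p * ((θ a *ₛ b) n + (a *ₛ θ b) n) + (x + y) * (a *ₛ b) n
      ≈⟨ +-congʳ (*-congˡ (θ-leibniz n a b)) ⟨
    p * θ (a *ₛ b) n + (x + y) * (a *ₛ b) n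
      ≈⟨ expand (x + y) (ι n) ((a *ₛ b) n) ⟨
    (p * ι n + (x + y)) * (a *ₛ b) n ∎
    where
    expand : ∀ x i s → (p * i + x) * s ≈ p * (i * s) + x * s
    expand = solve 4 (λ p x i s → (p :* i :+ x) :* s := p :* (i :* s) :+ x :* s) refl p

  expTerm : Carrier → Series
  expTerm x k = x ^ k ÷! k

  expTerm-solves : ∀ x → Solves 0# x (expTerm x)
  expTerm-solves x n = begin
    ι (suc n) * (x ^ suc n ÷! suc n)   ≈⟨ ÷!-suc n (x ^ suc n) ⟩
    x ^ suc n ÷! n                     ≈⟨ ÷!-≈-* n _ ⟩
    x * x ^ n * (1# ÷! n)              ≈⟨ solve 4 (λ x y w i → x :* y :* w := (:0 :* i :+ x) :* (y :* w))
         refl x (x ^ n) (1# ÷! n) (ι n) ⟩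
    (0# * ι n + x) * (x ^ n * (1# ÷! n)) ≈⟨ *-congˡ (÷!-≈-* n _) ⟨
    (0# * ι n + x) * (x ^ n ÷! n)      ∎

  expTerm-zero : ∀ x → expTerm x 0 ≈ 1#
  expTerm-zero x = trans (solve 1 (λ w → w := (:1 :+ :0) :* w) refl _) (!-*-÷! 0 1#)

  expTerm-+ : ∀ x y n → (expTerm x *ₛ expTerm y) n ≈ expTerm (x + y) n
  expTerm-+ x y = Solves-unique
    (begin
      expTerm x 0 * expTerm y 0 + 0#   ≈⟨ +-congʳ (*-cong (expTerm-zero x) (expTerm-zero y)) ⟩
      1# * 1# + 0#                     ≈⟨ solve 0 (:1 :* :1 :+ :0 := :1) refl ⟩
      1#                               ≈⟨ expTerm-zero (x + y) ⟨
      expTerm (x + y) 0                ∎)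
    (Solves-* (expTerm-solves x) (expTerm-solves y)) (expTerm-solves (x + y))

-- Binomial series, finite differences and the coefficients of the polynomials.

module Polynomials {c ℓ₁ ℓ₂} (R : RealField c ℓ₁ ℓ₂) where

  open RealField R hiding (zero)
  open RealDefs R
  open IntegerSolver commutativeRing
  open PowerSeries R
  open SetoidReasoning (CommutativeRing.setoid commutativeRing)

  falling-cong : ∀ {γ δ} n → γ ≈ δ → falling γ n ≈ falling δ n
  falling-cong zero    γ≈δ = refl
  falling-cong (suc n) γ≈δ = *-cong (falling-cong n γ≈δ) (+-congʳ γ≈δ)

  falling-suc : ∀ γ n → falling γ (suc n) ≈ γ * falling (γ - 1#) n
  falling-suc γ zero    = solve 1 (λ γ → :1 :* (γ :- :0) := γ :* :1) refl γ
  falling-suc γ (suc n) = begin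
    falling γ (suc n) * (γ - (1# + ι n))           ≈⟨ *-congʳ (falling-suc γ n) ⟩
    γ * falling (γ - 1#) n * (γ - (1# + ι n))      ≈⟨ solve 3 (λ γ f i → γ :* f :* (γ :- (:1 :+ i)) := γ :* (f :* (γ :- :1 :- i)))
         refl γ (falling (γ - 1#) n) (ι n) ⟩
    γ * (falling (γ - 1#) n * (γ - 1# - ι n))      ∎

  falling-reflect : ∀ γ n → falling (ι n - 1# - γ) n ≈ (- 1#) ^ n * falling γ n
  falling-reflect γ zero    = solve 0 (:1 := :1 :* :1) refl
  falling-reflect γ (suc n) = begin
    falling (1# + ι n - 1# - γ) (suc n)
      ≈⟨ falling-suc _ n ⟩
    (1# + ι n - 1# - γ) * falling (1# + ι n - 1# - γ - 1#) n
      ≈⟨ *-congˡ (falling-cong n (solve 2 (λ i γ → :1 :+ i :- :1 :- γ :- :1 := i :- :1 :- γ) refl (ι n) γ)) ⟩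
    (1# + ι n - 1# - γ) * falling (ι n - 1# - γ) n
      ≈⟨ *-congˡ (falling-reflect γ n) ⟩
    (1# + ι n - 1# - γ) * ((- 1#) ^ n * falling γ n)
      ≈⟨ solve 4 (λ i γ s f → (:1 :+ i :- :1 :- γ) :* (s :* f) := :- :1 :* s :* (f :* (γ :- i)))
           refl (ι n) γ ((- 1#) ^ n) (falling γ n) ⟩
    (- 1#) ^ suc n * falling γ (suc n) ∎

  !-*-[1-t]^ : ∀ γ n → ι (n !) * ([1-t]^ γ) n ≈ (- 1#) ^ n * falling γ n
  !-*-[1-t]^ γ n = trans
    (solve 3 (λ m s f → m :* (s :* f) := s :* (m :* f)) refl (ι (n !)) ((- 1#) ^ n) (falling γ n ÷! n))
    (*-congˡ (!-*-÷! n (falling γ n)))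

  [1-t]^-zero : ∀ γ → ([1-t]^ γ) 0 ≈ 1#
  [1-t]^-zero γ = trans (solve 1 (λ x → x := (:1 :+ :0) :* x) refl _)
    (trans (!-*-[1-t]^ γ 0) (*-identityˡ 1#))

  [1-t]^-solves : ∀ γ → Solves 1# (- γ) ([1-t]^ γ)
  [1-t]^-solves γ n = begin
    ι (suc n) * ((- 1#) ^ suc n * (falling γ (suc n) ÷! suc n))
      ≈⟨ solve 3 (λ m s f → m :* (s :* f) := s :* (m :* f))
           refl (ι (suc n)) ((- 1#) ^ suc n) (falling γ (suc n) ÷! suc n) ⟩
    (- 1#) ^ suc n * (ι (suc n) * (falling γ (suc n) ÷! suc n))
      ≈⟨ *-congˡ (trans (÷!-suc n (falling γ (suc n))) (÷!-≈-* n _)) ⟩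
    - 1# * (- 1#) ^ n * (falling γ n * (γ - ι n) * (1# ÷! n))
      ≈⟨ solve 5 (λ s f γ i w → :- :1 :* s :* (f :* (γ :- i) :* w) := (:1 :* i :+ :- γ) :* (s :* (f :* w)))
           refl ((- 1#) ^ n) (falling γ n) γ (ι n) (1# ÷! n) ⟩
    (1# * ι n + - γ) * ((- 1#) ^ n * (falling γ n * (1# ÷! n)))
      ≈⟨ *-congˡ (*-congˡ (÷!-≈-* n _)) ⟨
    (1# * ι n + - γ) * ([1-t]^ γ) n ∎

  -- The Chu-Vandermonde identity without binomial sums: both sides solve the same recurrence and
  -- start with 1.
  [1-t]^-+ : ∀ γ δ n → (([1-t]^ γ) *ₛ ([1-t]^ δ)) n ≈ ([1-t]^ (γ + δ)) n
  [1-t]^-+ γ δ = Solves-unique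
    (trans (+-congʳ (*-cong ([1-t]^-zero γ) ([1-t]^-zero δ)))
      (trans (solve 0 (:1 :* :1 :+ :0 := :1) refl) (sym ([1-t]^-zero (γ + δ)))))
    (λ n → trans (Solves-* ([1-t]^-solves γ) ([1-t]^-solves δ) n)
      (*-congʳ (+-congˡ (solve 2 (λ γ δ → :- γ :+ :- δ := :- (γ :+ δ)) refl γ δ))))
    ([1-t]^-solves (γ + δ))

  -- Δ β n k α = n! [tⁿ] (1 - t)^α ((1 - t)^β - 1)ᵏ: the k-th difference with
  -- step β of γ ↦ (-1)ⁿ γ (γ - 1) ⋯ (γ - n + 1).
  Δ : Carrier → ℕ → ℕ → Carrier → Carrier
  Δ β n zero    α = (- 1#) ^ n * falling α n
  Δ β n (suc k) α = Δ β n k (α + β) - Δ β n k α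

  Δ-cong : ∀ {β β′} n k {α α′} → β ≈ β′ → α ≈ α′ → Δ β n k α ≈ Δ β′ n k α′
  Δ-cong n zero    β≈β′ α≈α′ = *-congˡ (falling-cong n α≈α′)
  Δ-cong n (suc k) β≈β′ α≈α′ = +-cong (Δ-cong n k β≈β′ (+-cong α≈α′ β≈β′)) (-‿cong (Δ-cong n k β≈β′ α≈α′))

  -- The map γ ↦ n - 1 - γ turns steps of β into steps of - β, so differences go over to
  -- differences; the sign comes from the falling factorial only.
  Δ-reflect : ∀ β n k α → Δ β n k α ≈ (- 1#) ^ n * Δ (- β) n k (ι n - 1# - α)
  Δ-reflect β n zero    α = *-congˡ (begin
    falling α n
      ≈⟨ falling-cong n (solve 2 (λ i α → α := i :- :1 :- (i :- :1 :- α)) refl (ι n) α) ⟩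
    falling (ι n - 1# - (ι n - 1# - α)) n
      ≈⟨ falling-reflect (ι n - 1# - α) n ⟩
    (- 1#) ^ n * falling (ι n - 1# - α) n ∎)
  Δ-reflect β n (suc k) α = begin
    Δ β n k (α + β) - Δ β n k α
      ≈⟨ +-cong (Δ-reflect β n k (α + β)) (-‿cong (Δ-reflect β n k α)) ⟩
    (- 1#) ^ n * Δ (- β) n k (ι n - 1# - (α + β)) - (- 1#) ^ n * Δ (- β) n k (ι n - 1# - α)
      ≈⟨ +-congʳ (*-congˡ (Δ-cong n k refl (solve 3 (λ i α β → i :- :1 :- (α :+ β) := i :- :1 :- α :+ :- β)
           refl (ι n) α β))) ⟩
    (- 1#) ^ n * Δ (- β) n k (ι n - 1# - α + - β) - (- 1#) ^ n * Δ (- β) n k (ι n - 1# - α)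
      ≈⟨ solve 3 (λ s a b → s :* a :- s :* b := s :* (a :- b)) refl _ _ _ ⟩
    (- 1#) ^ n * (Δ (- β) n k (ι n - 1# - α + - β) - Δ (- β) n k (ι n - 1# - α)) ∎

  Δ-zero : ∀ β n α → Δ β (suc n) 0 α ≈ (ι n - α) * Δ β n 0 α
  Δ-zero β n α = solve 4 (λ s f α i → :- :1 :* s :* (f :* (α :- i)) := (i :- α) :* (s :* f))
       refl ((- 1#) ^ n) (falling α n) α (ι n)

  -- The discrete Leibniz rule for multiplication by n - γ, a factor whose second differences
  -- vanish.
  Δ-suc : ∀ β n k α → Δ β (suc n) (suc k) α ≈
    (ι n - α - ι (suc k) * β) * Δ β n (suc k) α - ι (suc k) * β * Δ β n k α
  Δ-suc β n zero    α = trans (+-cong (Δ-zero β n (α + β)) (-‿cong (Δ-zero β n α)))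
    (solve 5 (λ i α β a b → (i :- (α :+ β)) :* a :- (i :- α) :* b
      := (i :- α :- (:1 :+ :0) :* β) :* (a :- b) :- (:1 :+ :0) :* β :* b)
           refl (ι n) α β (Δ β n 0 (α + β)) (Δ β n 0 α))
  Δ-suc β n (suc k) α = trans (+-cong (Δ-suc β n k (α + β)) (-‿cong (Δ-suc β n k α)))
    (solve 7 (λ i α β j a b d →
      (i :- (α :+ β) :- j :* β) :* (a :- b) :- j :* β :* b
        :- ((i :- α :- j :* β) :* (b :- d) :- j :* β :* d)
      := (i :- α :- (:1 :+ j) :* β) :* (a :- b :- (b :- d)) :- (:1 :+ j) :* β :* (b :- d))
      refl (ι n) α β (ι (suc k)) (Δ β n k (α + β + β)) (Δ β n k (α + β)) (Δ β n k α))

  -- Differences of order above the degree n of the function of γ. In the inductive step both terms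
  -- of `Δ-suc` are again of order above the degree.
  Δ-vanish : ∀ β n k α → n ℕ.< k → Δ β n k α ≈ 0#
  Δ-vanish β zero    (suc zero)    α _ = solve 0 (:1 :* :1 :- :1 :* :1 := :0) refl
  Δ-vanish β zero    (suc (suc k)) α _ = trans
    (+-cong (Δ-vanish β zero (suc k) (α + β) (s≤s z≤n)) (-‿cong (Δ-vanish β zero (suc k) α (s≤s z≤n)))) (-‿inverseʳ 0#)
  Δ-vanish β (suc n) (suc k)       α (s≤s n<k) = trans (Δ-suc β n k α)
    (trans (+-cong (*-congˡ (Δ-vanish β n (suc k) α (m≤n⇒m≤1+n n<k))) (-‿cong (*-congˡ (Δ-vanish β n k α n<k))))
      (solve 2 (λ a b → a :* :0 :- b :* :0 := :0) refl _ _))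

  coeff : (α β : Carrier) → ℕ → ℕ → Carrier
  coeff α β n k = Δ β n k α * (1# ÷! k)

  -- The recurrence P_{n+1}(y) = (n - α - β y) P_n(y) - β y P_n′(y), with an
  -- arbitrary sequence φ in place of the powers of y.
  coeff-recurrence : ∀ α β n (φ : ℕ → Carrier) →
    ∑ (suc (suc n)) (λ k → coeff α β (suc n) k * φ k) ≈
    ∑ (suc n) (λ k → coeff α β n k * ((ι n - α - ι k * β) * φ k - β * φ (suc k)))
  coeff-recurrence α β n φ = begin
    coeff α β (suc n) 0 * φ 0 + ∑ (suc n) (λ k → coeff α β (suc n) (suc k) * φ (suc k))
      ≈⟨ +-cong (trans (*-congʳ coeff-zero) (regroup 0)) (∑-cong (suc n) (λ k → trans (*-congʳ (coeff-suc k)) (split k))) ⟩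
    1# * f 0 + ∑ (suc n) (λ k → 1# * f (suc k) + (- β) * g k)
      ≈⟨ +-cong (*-identityˡ _) (trans (∑-linear (suc n) 1# (- β) (f ∘ suc) g) (+-congʳ (*-identityˡ _))) ⟩
    f 0 + (∑ (suc n) (f ∘ suc) + (- β) * ∑ (suc n) g)
      ≈⟨ +-assoc _ _ _ ⟨
    ∑ (suc (suc n)) f + (- β) * ∑ (suc n) g
      -- The index `suc n` exceeds the degree, so `f` vanishes there and both sums acquire the same
      -- range.
      ≈⟨ +-congʳ (trans (∑-last (suc n) f) (trans (+-congˡ f-vanish) (+-identityʳ _))) ⟩
    ∑ (suc n) f + (- β) * ∑ (suc n) g
      ≈⟨ +-congʳ (*-identityˡ _) ⟨
    1# * ∑ (suc n) f + (- β) * ∑ (suc n) g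
      ≈⟨ ∑-linear (suc n) 1# (- β) f g ⟨
    ∑ (suc n) (λ k → 1# * f k + (- β) * g k)
      ≈⟨ ∑-cong (suc n) (λ k → solve 5 (λ a m x b y → :1 :* (a :* (m :* x)) :+ :- b :* (a :* y) := a :* (m :* x :- b :* y))
           refl (coeff α β n k) (ι n - α - ι k * β) (φ k) β (φ (suc k))) ⟩
    ∑ (suc n) (λ k → coeff α β n k * ((ι n - α - ι k * β) * φ k - β * φ (suc k))) ∎
    where
    f g : ℕ → Carrier
    f k = coeff α β n k * ((ι n - α - ι k * β) * φ k)
    g k = coeff α β n k * φ (suc k)

    f-vanish : f (suc n) ≈ 0#
    f-vanish = trans (*-congʳ (trans (*-congʳ (Δ-vanish β n (suc n) α ≤-refl)) (zeroˡ _))) (zeroˡ _)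

    coeff-zero : coeff α β (suc n) 0 ≈ (ι n - α - ι 0 * β) * coeff α β n 0
    coeff-zero = trans (*-congʳ (Δ-zero β n α))
      (solve 5 (λ i α β d w → (i :- α) :* d :* w := (i :- α :- :0 :* β) :* (d :* w))
           refl (ι n) α β (Δ β n 0 α) (1# ÷! 0))

    coeff-suc : ∀ k → coeff α β (suc n) (suc k) ≈
      (ι n - α - ι (suc k) * β) * coeff α β n (suc k) - β * coeff α β n k
    coeff-suc k = trans (*-congʳ (Δ-suc β n k α))
      (trans (solve 6 (λ m j β x y w → (m :* x :- j :* β :* y) :* w := m :* (x :* w) :- β :* (y :* (j :* w)))
          refl (ι n - α - ι (suc k) * β) (ι (suc k)) β (Δ β n (suc k) α) (Δ β n k α) (1# ÷! suc k))
        (+-congˡ (-‿cong (*-congˡ (*-congˡ (÷!-suc k 1#))))))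

    regroup : ∀ k → (ι n - α - ι k * β) * coeff α β n k * φ k ≈ 1# * f k
    regroup k = solve 3 (λ m a x → m :* a :* x := :1 :* (a :* (m :* x)))
         refl (ι n - α - ι k * β) (coeff α β n k) (φ k)

    split : ∀ k → ((ι n - α - ι (suc k) * β) * coeff α β n (suc k) - β * coeff α β n k) * φ (suc k)
      ≈ 1# * f (suc k) + (- β) * g k
    split k = solve 5 (λ m a b y x → (m :* a :- b :* y) :* x := :1 :* (a :* (m :* x)) :+ :- b :* (y :* x))
      refl (ι n - α - ι (suc k) * β) (coeff α β n (suc k)) β (coeff α β n k) (φ (suc k))

  ^ₛ-scale : ∀ k x (v : Series) n → ((x •ₛ v) ^ₛ k) n ≈ x ^ k * (v ^ₛ k) n
  ^ₛ-scale zero    x v n = sym (*-identityˡ _)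
  ^ₛ-scale (suc k) x v n = begin
    ((x •ₛ v) *ₛ ((x •ₛ v) ^ₛ k)) n
      ≈⟨ *ₛ-congˡ n (x •ₛ v) ((x •ₛ v) ^ₛ k) (λ j → x ^ k * (v ^ₛ k) j) (^ₛ-scale k x v) ⟩
    ((x •ₛ v) *ₛ (λ j → x ^ k * (v ^ₛ k) j)) n
      ≈⟨ *ₛ-scaleʳ n (x ^ k) (x •ₛ v) (v ^ₛ k) ⟩
    x ^ k * ((x •ₛ v) *ₛ (v ^ₛ k)) n
      ≈⟨ *-congˡ (*ₛ-congʳ n (x •ₛ v) (λ j → x * v j + 0# * v j) (v ^ₛ k)
           (λ j → solve 2 (λ x v → x :* v := x :* v :+ :0 :* v) refl x (v j))) ⟩
    x ^ k * ((λ j → x * v j + 0# * v j) *ₛ (v ^ₛ k)) n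
      ≈⟨ *-congˡ (*ₛ-linearˡ n x 0# v v (v ^ₛ k)) ⟩
    x ^ k * (x * (v *ₛ (v ^ₛ k)) n + 0# * (v *ₛ (v ^ₛ k)) n)
      ≈⟨ solve 3 (λ x y z → y :* (x :* z :+ :0 :* z) := x :* y :* z) refl x (x ^ k) _ ⟩
    x ^ suc k * (v *ₛ (v ^ₛ k)) n ∎

  ^ₛ-vanish : ∀ k (v : Series) n → v 0 ≈ 0# → n ℕ.< k → (v ^ₛ k) n ≈ 0#
  ^ₛ-vanish (suc k) v zero    v₀≈0 _         = trans (+-identityʳ _) (trans (*-congʳ v₀≈0) (zeroˡ _))
  ^ₛ-vanish (suc k) v (suc n) v₀≈0 (s≤s n<k) = trans
    (+-cong (trans (*-congʳ v₀≈0) (zeroˡ _))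
      (trans (*ₛ-congˡ-≤ n (v ∘ suc) (v ^ₛ k) (λ _ → 0#) (λ j j≤n → ^ₛ-vanish k v j v₀≈0 (≤-trans (s≤s j≤n) n<k)))
        (*ₛ-zeroʳ n (v ∘ suc))))
    (+-identityˡ 0#)

  -- One factor (1 - t)^β - 1 turns (1 - t)^α into (1 - t)^(α + β) - (1 - t)^α, which is the
  -- difference step of `Δ`.
  !-*-binomial-^ₛ : ∀ β n k α →
    ι (n !) * (([1-t]^ α) *ₛ ((([1-t]^ β) -ₛ oneₛ) ^ₛ k)) n ≈ Δ β n k α
  !-*-binomial-^ₛ β n zero    α = trans (*-congˡ (*ₛ-identityʳ n ([1-t]^ α))) (!-*-[1-t]^ α n)
  !-*-binomial-^ₛ β n (suc k) α = begin
    ι (n !) * (A α *ₛ (v *ₛ (v ^ₛ k))) n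
      ≈⟨ *-congˡ (*ₛ-assoc n (A α) v (v ^ₛ k)) ⟨
    ι (n !) * ((A α *ₛ v) *ₛ (v ^ₛ k)) n
      ≈⟨ *-congˡ (*ₛ-congʳ n (A α *ₛ v) (λ j → 1# * A (α + β) j + (- 1#) * A α j) (v ^ₛ k) Av) ⟩
    ι (n !) * ((λ j → 1# * A (α + β) j + (- 1#) * A α j) *ₛ (v ^ₛ k)) n
      ≈⟨ *-congˡ (*ₛ-linearˡ n 1# (- 1#) (A (α + β)) (A α) (v ^ₛ k)) ⟩
    ι (n !) * (1# * (A (α + β) *ₛ (v ^ₛ k)) n + (- 1#) * (A α *ₛ (v ^ₛ k)) n)
      ≈⟨ solve 3 (λ m x y → m :* (:1 :* x :+ :- :1 :* y) := m :* x :- m :* y) refl (ι (n !)) _ _ ⟩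
    ι (n !) * (A (α + β) *ₛ (v ^ₛ k)) n - ι (n !) * (A α *ₛ (v ^ₛ k)) n
      ≈⟨ +-cong (!-*-binomial-^ₛ β n k (α + β)) (-‿cong (!-*-binomial-^ₛ β n k α)) ⟩
    Δ β n k (α + β) - Δ β n k α ∎
    where
    A : Carrier → Series
    A γ = [1-t]^ γ
    v : Series
    v = A β -ₛ oneₛ
    Av : ∀ j → (A α *ₛ v) j ≈ 1# * A (α + β) j + (- 1#) * A α j
    Av j = begin
      (A α *ₛ v) j
        ≈⟨ *ₛ-congˡ j (A α) v (λ i → 1# * A β i + (- 1#) * oneₛ i)
             (λ i → solve 2 (λ x y → x :- y := :1 :* x :+ :- :1 :* y) refl (A β i) (oneₛ i)) ⟩
      (A α *ₛ (λ i → 1# * A β i + (- 1#) * oneₛ i)) j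
        ≈⟨ *ₛ-linearʳ j 1# (- 1#) (A α) (A β) oneₛ ⟩
      1# * (A α *ₛ A β) j + (- 1#) * (A α *ₛ oneₛ) j
        ≈⟨ +-cong (*-congˡ ([1-t]^-+ α β j)) (*-congˡ (*ₛ-identityʳ j (A α))) ⟩
      1# * A (α + β) j + (- 1#) * A α j ∎

  P-expansion : ∀ α β n x → P α β n x ≈ ∑ (suc n) (λ k → coeff α β n k * x ^ k)
  P-expansion α β n x = begin
    ι (n !) * (A *ₛ expₛ (x •ₛ v)) n
      -- In degree j the series `expₛ` stops at k = j. As `v` has no constant term, the sum may run
      -- to k = n for every j ≤ n, and a range independent of j can be moved out of the product.
      ≈⟨ *-congˡ (*ₛ-congˡ-≤ n A (expₛ (x •ₛ v)) (λ j → ∑ (suc n) (λ k → g k j)) expₛ-expand) ⟩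
    ι (n !) * (A *ₛ (λ j → ∑ (suc n) (λ k → g k j))) n
      ≈⟨ *-congˡ (*ₛ-∑ (suc n) n A g) ⟩
    ι (n !) * ∑ (suc n) (λ k → (A *ₛ g k) n)
      ≈⟨ ∑-scale (suc n) (ι (n !)) (λ k → (A *ₛ g k) n) ⟨
    ∑ (suc n) (λ k → ι (n !) * (A *ₛ g k) n)
      ≈⟨ ∑-cong (suc n) term ⟩
    ∑ (suc n) (λ k → coeff α β n k * x ^ k) ∎
    where
    A v : Series
    A = [1-t]^ α
    v = ([1-t]^ β) -ₛ oneₛ
    g : ℕ → Series
    g k j = x ^ k * (1# ÷! k) * (v ^ₛ k) j

    v₀≈0 : v 0 ≈ 0#
    v₀≈0 = trans (+-congʳ ([1-t]^-zero β)) (-‿inverseʳ 1#)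

    expₛ-expand : ∀ j → j ℕ.≤ n → expₛ (x •ₛ v) j ≈ ∑ (suc n) (λ k → g k j)
    expₛ-expand j j≤n = trans
      (∑-cong (suc j) (λ k → trans (÷!-≈-* k _) (trans (*-congʳ (^ₛ-scale k x v j))
        (solve 3 (λ a b c → a :* b :* c := a :* c :* b) refl (x ^ k) ((v ^ₛ k) j) (1# ÷! k)))))
      (∑-extend (λ k → g k j) (s≤s j≤n) (λ k j<k → trans (*-congˡ (^ₛ-vanish k v j v₀≈0 j<k)) (zeroʳ _)))

    term : ∀ k → ι (n !) * (A *ₛ g k) n ≈ coeff α β n k * x ^ k
    term k = begin
      ι (n !) * (A *ₛ g k) n
        ≈⟨ *-congˡ (*ₛ-scaleʳ n (x ^ k * (1# ÷! k)) A (v ^ₛ k)) ⟩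
      ι (n !) * (x ^ k * (1# ÷! k) * (A *ₛ (v ^ₛ k)) n)
        ≈⟨ solve 4 (λ m y w s → m :* (y :* w :* s) := m :* s :* w :* y) refl (ι (n !)) (x ^ k) (1# ÷! k) _ ⟩
      ι (n !) * (A *ₛ (v ^ₛ k)) n * (1# ÷! k) * x ^ k
        ≈⟨ *-congʳ (*-congʳ (!-*-binomial-^ₛ β n k α)) ⟩
      coeff α β n k * x ^ k ∎

  P-reflect : ∀ α β n x → P α β n x ≈ (- 1#) ^ n * P (ι n - 1# - α) (- β) n x
  P-reflect α β n x = begin
    P α β n x
      ≈⟨ P-expansion α β n x ⟩
    ∑ (suc n) (λ k → coeff α β n k * x ^ k)
      ≈⟨ ∑-cong (suc n) (λ k → trans (*-congʳ (*-congʳ (Δ-reflect β n k α)))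
           (solve 4 (λ s d w y → s :* d :* w :* y := s :* (d :* w :* y)) refl ((- 1#) ^ n) _ (1# ÷! k) (x ^ k))) ⟩
    ∑ (suc n) (λ k → (- 1#) ^ n * (coeff (ι n - 1# - α) (- β) n k * x ^ k))
      ≈⟨ ∑-scale (suc n) ((- 1#) ^ n) (λ k → coeff (ι n - 1# - α) (- β) n k * x ^ k) ⟩
    (- 1#) ^ n * ∑ (suc n) (λ k → coeff (ι n - 1# - α) (- β) n k * x ^ k)
      ≈⟨ *-congˡ (P-expansion (ι n - 1# - α) (- β) n x) ⟨
    (- 1#) ^ n * P (ι n - 1# - α) (- β) n x ∎

-- The exponential function: addition law and inequalities.

module Exponential {c ℓ₁ ℓ₂} (R : RealField c ℓ₁ ℓ₂) (E : RealDefs.ExpLn R) where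

  open RealField R hiding (zero)
  open RealDefs R
  open RealDefs.ExpLn E
  open IntegerSolver commutativeRing
  open Order R
  open PowerSeries R
  open Exp semiring using (^-congˡ)
  open SetoidReasoning (CommutativeRing.setoid commutativeRing)

  -- A limit l of s is treated as a null sequence s - l, so that limit laws reduce to algebraic
  -- identities between terms.
  Null : (ℕ → Carrier) → Set _
  Null s = ∀ ε → 0# < ε → ∃ λ N → ∀ n → N ℕ.≤ n → s n ≼ ε

  Null-resp : ∀ {s t} → (∀ n → s n ≈ t n) → Null s → Null t
  Null-resp s≈t S ε 0<ε with S ε 0<ε
  ... | N , small = N , λ n N≤n → ≼-resp (s≈t n) refl (small n N≤n)

  Null-≼ : ∀ {s t} → (∀ n → s n ≼ t n) → Null t → Null s
  Null-≼ s≼t T ε 0<ε with T ε 0<ε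
  ... | N , small = N , λ n N≤n → ≼-weaken (s≼t n) (proj₁ (small n N≤n))

  Null-+ : ∀ {s t} → Null s → Null t → Null (λ n → s n + t n)
  Null-+ S T ε 0<ε with S (½ * ε) (*-pos 0<½ 0<ε) | T (½ * ε) (*-pos 0<½ 0<ε)
  ... | M , s-small | N , t-small = M ℕ.+ N , λ n M+N≤n →
    ≼-resp refl
      (trans (sym (distribʳ ε ½ ½)) (trans (*-congʳ ½+½≈1) (*-identityˡ ε)))
      (≼-+ (s-small n (≤-trans (m≤m+n M N) M+N≤n)) (t-small n (≤-trans (m≤n+m N M) M+N≤n)))

  Null-* : ∀ {s t} → Null s → Null t → Null (λ n → s n * t n)
  Null-* S T ε 0<ε with S ε 0<ε | T 1# 0<1
  ... | M , s-small | N , t-small = M ℕ.+ N , λ n M+N≤n →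
    ≼-resp refl (*-identityʳ ε)
      (≼-* (s-small n (≤-trans (m≤m+n M N) M+N≤n)) (t-small n (≤-trans (m≤n+m N M) M+N≤n)))

  Null-scale : ∀ {s} a → Null s → Null (λ n → a * s n)
  Null-scale a S ε 0<ε with bounded a
  ... | m , 0<m , a≼m with recip 0<m
  ... | w , 0<w , mw≈1 with S (w * ε) (*-pos 0<w 0<ε)
  ... | N , small = N , λ n N≤n →
    ≼-resp refl (trans (sym (*-assoc m w ε)) (trans (*-congʳ mw≈1) (*-identityˡ ε))) (≼-* a≼m (small n N≤n))

  Null-∘ : ∀ s (φ : ℕ → ℕ) → (∀ n → n ℕ.≤ φ n) → Null s → Null (s ∘ φ)
  Null-∘ s φ n≤φ S ε 0<ε with S ε 0<ε
  ... | N , small = N , λ n N≤n → small (φ n) (≤-trans N≤n (n≤φ n))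

  Null-const : ∀ {x} → Null (λ _ → x) → x ≈ 0#
  Null-const X = ≼-small 0<1 λ ε 0<ε →
    ≼-resp refl (sym (*-identityˡ ε)) (proj₂ (X ε 0<ε) (proj₁ (X ε 0<ε)) ≤-refl)

  0≤-limit : ∀ (s : ℕ → Carrier) l → Null (λ n → s n - l) → (∀ n → 0≤ s n) → 0≤ l
  0≤-limit s l S 0≤s = 0≤-resp (solve 1 (λ l → :- :- l := l) refl l)
    (0≤-small 0<1 λ ε 0<ε → let N , small = S ε 0<ε in
      0≤-resp (solve 3 (λ ε s l → ε :- (s :- l) :+ s := :1 :* ε :- :- l) refl ε (s N) l)
        (0≤-+ (proj₁ (small N ≤-refl)) (0≤s N)))

  ∑-≼ : ∀ n {a A : ℕ → Carrier} → (∀ k → a k ≼ A k) → ∑ n a ≼ ∑ n A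
  ∑-≼ zero    a≼A = 0≤⇒≼ (0≤-≈0 refl)
  ∑-≼ (suc n) a≼A = ≼-+ (a≼A 0) (∑-≼ n (a≼A ∘ suc))

  ∑-0≤ : ∀ n {a : ℕ → Carrier} → (∀ k → 0≤ a k) → 0≤ ∑ n a
  ∑-0≤ n {a} 0≤a = ≼⇒0≤ (∑-≼ n {a} {a} (λ k → 0≤⇒≼ (0≤a k)))

  ∑-mono : ∀ {m n} (a : ℕ → Carrier) → m ℕ.≤ n → (∀ k → 0≤ a k) → 0≤ ∑ n a - ∑ m a
  ∑-mono {zero} {n} a _ 0≤a = 0≤-resp (solve 1 (λ s → s := s :- :0) refl (∑ n a)) (∑-0≤ n 0≤a)
  ∑-mono {suc m} {suc n} a (s≤s m≤n) 0≤a = 0≤-resp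
    (solve 3 (λ x s t → s :- t := x :+ s :- (x :+ t)) refl (a 0) (∑ n (a ∘ suc)) (∑ m (a ∘ suc)))
    (∑-mono (a ∘ suc) m≤n (0≤a ∘ suc))

  ∑-*ₛ-suc : ∀ n (a b : Series) → ∑ (suc n) (a *ₛ b) ≈ a 0 * ∑ (suc n) b + ∑ n ((a ∘ suc) *ₛ b)
  ∑-*ₛ-suc n a b = begin
    (a 0 * b 0 + 0#) + ∑ n (λ k → a 0 * b (suc k) + ((a ∘ suc) *ₛ b) k)
      ≈⟨ +-congˡ (∑-cong n (λ k → +-congˡ {a 0 * b (suc k)} (sym (*-identityˡ (((a ∘ suc) *ₛ b) k))))) ⟩
    (a 0 * b 0 + 0#) + ∑ n (λ k → a 0 * b (suc k) + 1# * ((a ∘ suc) *ₛ b) k)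
      ≈⟨ +-congˡ (∑-linear n (a 0) 1# (b ∘ suc) ((a ∘ suc) *ₛ b)) ⟩
    (a 0 * b 0 + 0#) + (a 0 * ∑ n (b ∘ suc) + 1# * ∑ n ((a ∘ suc) *ₛ b))
      ≈⟨ solve 4 (λ a b s t → (a :* b :+ :0) :+ (a :* s :+ :1 :* t) := a :* (b :+ s) :+ t) refl (a 0) (b 0) _ _ ⟩
    a 0 * ∑ (suc n) b + ∑ n ((a ∘ suc) *ₛ b) ∎

  -- The sum of `a i * b j` over i, j < n with i + j ≥ n, which the partial sum of the Cauchy
  -- product misses.
  defect : ℕ → Series → Series → Carrier
  defect n a b = ∑ n a * ∑ n b - ∑ n (a *ₛ b)

  defect-suc : ∀ n a b → defect (suc n) a b ≈ defect n (a ∘ suc) b + ∑ n (a ∘ suc) * b n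
  defect-suc n a b = begin
    (a 0 + ∑ n (a ∘ suc)) * ∑ (suc n) b - ∑ (suc n) (a *ₛ b)
      ≈⟨ +-congˡ (-‿cong (∑-*ₛ-suc n a b)) ⟩
    (a 0 + ∑ n (a ∘ suc)) * ∑ (suc n) b - (a 0 * ∑ (suc n) b + ∑ n ((a ∘ suc) *ₛ b))
      ≈⟨ solve 4 (λ a s b t → (a :+ s) :* b :- (a :* b :+ t) := s :* b :- t)
           refl (a 0) (∑ n (a ∘ suc)) (∑ (suc n) b) _ ⟩
    ∑ n (a ∘ suc) * ∑ (suc n) b - ∑ n ((a ∘ suc) *ₛ b)
      ≈⟨ +-congʳ (*-congˡ (∑-last n b)) ⟩
    ∑ n (a ∘ suc) * (∑ n b + b n) - ∑ n ((a ∘ suc) *ₛ b)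
      ≈⟨ solve 4 (λ s b x t → s :* (b :+ x) :- t := s :* b :- t :+ s :* x) refl (∑ n (a ∘ suc)) (∑ n b) (b n) _ ⟩
    defect n (a ∘ suc) b + ∑ n (a ∘ suc) * b n ∎

  -- Although written as a difference, the defect is a sum of products with positive signs, as
  -- `defect-suc` exhibits; hence termwise bounds carry over.
  defect-≼ : ∀ n {a A b B} → (∀ k → a k ≼ A k) → (∀ k → b k ≼ B k) → defect n a b ≼ defect n A B
  defect-≼ zero a≼A b≼B = ≼-resp zero-defect zero-defect (0≤⇒≼ (0≤-≈0 refl))
    where
    zero-defect : 0# ≈ 0# * 0# - 0#
    zero-defect = solve 0 (:0 := :0 :* :0 :- :0) refl
  defect-≼ (suc n) {a} {A} {b} {B} a≼A b≼B = ≼-resp (sym (defect-suc n a b)) (sym (defect-suc n A B))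
    (≼-+ (defect-≼ n (a≼A ∘ suc) b≼B) (≼-* (∑-≼ n (a≼A ∘ suc)) (b≼B n)))

  *ₛ-0≤ : ∀ n {a b : Series} → (∀ k → 0≤ a k) → (∀ k → 0≤ b k) → 0≤ (a *ₛ b) n
  *ₛ-0≤ n 0≤a 0≤b = ∑-0≤ (suc n) (λ k → 0≤-* (0≤a k) (0≤b (n ∸ k)))

  -- The rectangle i < m, j < n lies in the triangle i + j < m + n.
  ∑-*-≤ : ∀ m n (a b : Series) → (∀ k → 0≤ a k) → (∀ k → 0≤ b k) →
    0≤ ∑ (m ℕ.+ n) (a *ₛ b) - ∑ m a * ∑ n b
  ∑-*-≤ zero    n a b 0≤a 0≤b = 0≤-resp (solve 2 (λ s t → s := s :- :0 :* t) refl _ (∑ n b))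
    (∑-0≤ n (λ k → *ₛ-0≤ k {a} {b} 0≤a 0≤b))
  ∑-*-≤ (suc m) n a b 0≤a 0≤b = 0≤-resp
    (begin
      a 0 * (∑ (suc (m ℕ.+ n)) b - ∑ n b) + (∑ (m ℕ.+ n) ((a ∘ suc) *ₛ b) - ∑ m (a ∘ suc) * ∑ n b)
        ≈⟨ solve 5 (λ a s t u v → a :* (s :- t) :+ (u :- v :* t) := a :* s :+ u :- (a :+ v) :* t)
             refl (a 0) (∑ (suc (m ℕ.+ n)) b) (∑ n b) _ (∑ m (a ∘ suc)) ⟩
      a 0 * ∑ (suc (m ℕ.+ n)) b + ∑ (m ℕ.+ n) ((a ∘ suc) *ₛ b) - (a 0 + ∑ m (a ∘ suc)) * ∑ n b
        ≈⟨ +-congʳ (∑-*ₛ-suc (m ℕ.+ n) a b) ⟨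
      ∑ (suc (m ℕ.+ n)) (a *ₛ b) - ∑ (suc m) a * ∑ n b ∎)
    (0≤-+ (0≤-* (0≤a 0) (∑-mono b (m≤n⇒m≤1+n (m≤n+m n m)) 0≤b)) (∑-*-≤ m n (a ∘ suc) b (0≤a ∘ suc) 0≤b))

  0<ι : ∀ m .{{_ : NonZero m}} → 0# < ι m
  0<ι (suc m) = ι-pos m

  0≤-1÷! : ∀ k → 0≤ 1# ÷! k
  0≤-1÷! k = 0≤-cancelˡ (0<ι (k !) {{k !≢0}}) (0≤-resp (sym (!-*-÷! k 1#)) 0≤1)

  expTerm-≼ : ∀ {x m} → x ≼ m → ∀ k → expTerm x k ≼ expTerm m k
  expTerm-≼ {x} {m} x≼m k = ≼-resp (sym (÷!-≈-* k _)) (sym (÷!-≈-* k _)) (≼-* (pow k) (0≤⇒≼ (0≤-1÷! k)))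
    where
    pow : ∀ k → x ^ k ≼ m ^ k
    pow zero    = 0≤⇒≼ 0≤1
    pow (suc k) = ≼-* x≼m (pow k)

  expTerm-0≤ : ∀ {x} → 0≤ x → ∀ k → 0≤ expTerm x k
  expTerm-0≤ 0≤x k = ≼⇒0≤ (expTerm-≼ (0≤⇒≼ 0≤x) k)

  exp-limit : ∀ x → Null (λ n → ∑ n (expTerm x) - exp x)
  exp-limit x ε 0<ε with exp-series x ε 0<ε
  ... | N , close = N , λ n N≤n → ∣-∣<⇒≼ (close n N≤n)

  exp-cong : ∀ {x y} → x ≈ y → exp x ≈ exp y
  exp-cong {x} {y} x≈y = trans (solve 2 (λ a b → a := b :+ (a :- b)) refl (exp x) (exp y))
    (trans (+-congˡ (Null-const (Null-resp
        (λ n → trans (+-congˡ (*-congˡ (+-congʳ (∑-cong n terms))))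
          (solve 3 (λ a b s → s :- b :+ :- :1 :* (s :- a) := a :- b) refl (exp x) (exp y) (∑ n (expTerm y))))
        (Null-+ (exp-limit y) (Null-scale (- 1#) (exp-limit x))))))
      (+-identityʳ _))
    where
    terms : ∀ k → expTerm x k ≈ expTerm y k
    terms k = trans (÷!-≈-* k _) (trans (*-congʳ (^-congˡ k x≈y)) (sym (÷!-≈-* k _)))

  -- For ∣x∣ ≤ p and ∣y∣ ≤ q, the defect is at most a tail of the series of exp (p + q).
  exp-defect : ∀ {x y p q} → 0≤ p → 0≤ q → x ≼ p → y ≼ q → Null (λ n → defect n (expTerm x) (expTerm y))
  exp-defect {x} {y} {p} {q} 0≤p 0≤q x≼p y≼q =
    Null-≼ (λ n → defect-≼ n (expTerm-≼ x≼p) (expTerm-≼ y≼q))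
      (Null-≼ (λ n → ≼-weaken (0≤⇒≼ (defect-0≤ n)) (tail-bound n)) tail-null)
    where
    a b : Series
    a = expTerm p
    b = expTerm q
    0≤a : ∀ k → 0≤ a k
    0≤a = expTerm-0≤ 0≤p
    0≤b : ∀ k → 0≤ b k
    0≤b = expTerm-0≤ 0≤q
    defect-0≤ : ∀ n → 0≤ defect n a b
    defect-0≤ n = ≼⇒0≤ (defect-≼ n (λ k → 0≤⇒≼ (0≤a k)) (λ k → 0≤⇒≼ (0≤b k)))
    S : ℕ → Carrier
    S n = ∑ n (expTerm (p + q))
    tail-null : Null (λ n → S (n ℕ.+ n) - S n)
    tail-null = Null-resp
      (λ n → solve 3 (λ s t e → s :- e :+ :- :1 :* (t :- e) := s :- t) refl (S (n ℕ.+ n)) (S n) (exp (p + q)))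
      (Null-+ (Null-∘ (λ n → S n - exp (p + q)) (λ n → n ℕ.+ n) (λ n → m≤m+n n n) (exp-limit (p + q)))
        (Null-scale (- 1#) (exp-limit (p + q))))
    tail-bound : ∀ n → 0≤ S (n ℕ.+ n) - S n - defect n a b
    tail-bound n = 0≤-resp
      (begin
        ∑ (n ℕ.+ n) (a *ₛ b) - ∑ n a * ∑ n b
          ≈⟨ solve 3 (λ s t u → s :- t := s :- u :- (t :- u))
               refl (∑ (n ℕ.+ n) (a *ₛ b)) (∑ n a * ∑ n b) (∑ n (a *ₛ b)) ⟩
        ∑ (n ℕ.+ n) (a *ₛ b) - ∑ n (a *ₛ b) - defect n a b
          ≈⟨ +-congʳ (+-cong (∑-cong (n ℕ.+ n) (expTerm-+ p q)) (-‿cong (∑-cong n (expTerm-+ p q)))) ⟩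
        S (n ℕ.+ n) - S n - defect n a b ∎)
      (∑-*-≤ n n a b 0≤a 0≤b)

  exp-+ : ∀ x y → exp (x + y) ≈ exp x * exp y
  exp-+ x y = trans (solve 2 (λ a b → a := b :+ (a :- b)) refl (exp (x + y)) (exp x * exp y))
    (trans (+-congˡ (Null-const (Null-resp
        (λ n → trans (+-congˡ (*-congˡ (+-congʳ (sym (∑-cong n (expTerm-+ x y))))))
          -- With partial sums s, t of the two series and u of their product, the constant e - l m
          -- is (s - l)(t - m) plus two cross terms, minus the defect s t - u, minus u - e; all of
          -- these are null.
          (solve 6 (λ s t u l m e → (s :- l) :* (t :- m) :+ (m :* (s :- l) :+ l :* (t :- m)) :+ :- :1 :* (s :* t :- u) :+ :- :1 :* (u :- e) := e :- l :* m)
            refl (∑ n (expTerm x)) (∑ n (expTerm y)) (∑ n (expTerm x *ₛ expTerm y)) (exp x) (exp y) (exp (x + y))))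
        (Null-+ (Null-+ (Null-+ (Null-* (exp-limit x) (exp-limit y))
              (Null-+ (Null-scale (exp y) (exp-limit x)) (Null-scale (exp x) (exp-limit y))))
            (Null-scale (- 1#) (exp-defect (0<⇒0≤ (proj₁ (proj₂ (bounded x)))) (0<⇒0≤ (proj₁ (proj₂ (bounded y)))) (proj₂ (proj₂ (bounded x))) (proj₂ (proj₂ (bounded y))))))
          (Null-scale (- 1#) (exp-limit (x + y)))))))
      (+-identityʳ _))

  1+x≤exp : ∀ {x} → 0≤ x → 0≤ exp x - (1# + x)
  1+x≤exp {x} 0≤x = 0≤-limit (λ n → ∑ (suc (suc n)) (expTerm x) - (1# + x)) _
    (Null-resp (λ n → solve 3 (λ s e x → s :- e := s :- (:1 :+ x) :- (e :- (:1 :+ x)))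
         refl (∑ (suc (suc n)) (expTerm x)) (exp x) x)
      (Null-∘ (λ n → ∑ n (expTerm x) - exp x) (λ n → suc (suc n)) (λ n → m≤n⇒m≤1+n (n≤1+n n)) (exp-limit x)))
    (λ n → 0≤-resp (rest n) (∑-0≤ n (λ k → expTerm-0≤ 0≤x (suc (suc k)))))
    where
    expTerm-one : expTerm x 1 ≈ x
    expTerm-one = begin
      expTerm x 1                        ≈⟨ solve 1 (λ t → t := (:1 :+ :0) :* t) refl _ ⟩
      ι 1 * expTerm x 1                  ≈⟨ expTerm-solves x 0 ⟩
      (0# * 0# + x) * expTerm x 0        ≈⟨ *-congˡ (expTerm-zero x) ⟩
      (0# * 0# + x) * 1#                 ≈⟨ solve 1 (λ x → (:0 :* :0 :+ x) :* :1 := x) refl x ⟩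
      x                                  ∎
    rest : ∀ n → ∑ n (λ k → expTerm x (suc (suc k))) ≈ ∑ (suc (suc n)) (expTerm x) - (1# + x)
    rest n = trans (solve 2 (λ x r → r := :1 :+ (x :+ r) :- (:1 :+ x)) refl x (∑ n (λ k → expTerm x (suc (suc k)))))
      (+-congʳ (+-cong (sym (expTerm-zero x)) (+-congʳ (sym expTerm-one))))

  -- Multiplying the partial sum up to x^n / n! by 1 - x telescopes to 1 - Σ (k - 1) x^k / k! -
  -- x^(n+1) / n!, the sum running over 1 ≤ k ≤ n; everything subtracted is nonnegative.
  [1-x]exp≤1 : ∀ {x} → 0≤ x → 0≤ 1# - (1# - x) * exp x
  [1-x]exp≤1 {x} 0≤x = 0≤-limit (λ n → 1# - (1# - x) * ∑ (suc n) (expTerm x)) _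
    (Null-resp (λ n → solve 3 (λ x s e → :- (:1 :- x) :* (s :- e) := :1 :- (:1 :- x) :* s :- (:1 :- (:1 :- x) :* e))
         refl x (∑ (suc n) (expTerm x)) (exp x))
      (Null-scale (- (1# - x)) (Null-∘ (λ n → ∑ n (expTerm x) - exp x) suc n≤1+n (exp-limit x))))
    (λ n → 0≤-resp (solve 2 (λ a b → a :- b :+ b := a)
         refl (1# - (1# - x) * ∑ (suc n) (expTerm x)) (x * expTerm x n))
      (0≤-+ (sharper n) (0≤-* 0≤x (expTerm-0≤ 0≤x n))))
    where
    -- The last term is kept for the induction and dropped in the limit: from n to n + 1 the
    -- expression grows by exactly n x^(n+1) / (n+1)!.
    sharper : ∀ n → 0≤ 1# - (1# - x) * ∑ (suc n) (expTerm x) - x * expTerm x n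
    sharper zero    = 0≤-≈0 (trans
      (+-cong (+-congˡ (-‿cong (*-congˡ (+-congʳ (expTerm-zero x))))) (-‿cong (*-congˡ (expTerm-zero x))))
      (solve 1 (λ x → :1 :- (:1 :- x) :* (:1 :+ :0) :- x :* :1 := :0) refl x))
    sharper (suc n) = 0≤-resp
      (begin
        1# - (1# - x) * S - x * expTerm x n + ι n * τ
          ≈⟨ solve 5 (λ x S t i τ → :1 :- (:1 :- x) :* S :- x :* t :+ i :* τ
               := :1 :- (:1 :- x) :* (S :+ τ) :- x :* τ :+ ((:1 :+ i) :* τ :- (:0 :* i :+ x) :* t))
                    refl x S (expTerm x n) (ι n) τ ⟩
        1# - (1# - x) * (S + τ) - x * τ + (ι (suc n) * τ - (0# * ι n + x) * expTerm x n)
          ≈⟨ +-congˡ (trans (+-congʳ (expTerm-solves x n)) (-‿inverseʳ _)) ⟩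
        1# - (1# - x) * (S + τ) - x * τ + 0#
          ≈⟨ +-identityʳ _ ⟩
        1# - (1# - x) * (S + τ) - x * τ
          ≈⟨ +-congʳ (+-congˡ (-‿cong (*-congˡ (∑-last (suc n) (expTerm x))))) ⟨
        1# - (1# - x) * ∑ (suc (suc n)) (expTerm x) - x * τ ∎)
      (0≤-+ (sharper n) (0≤-* (0≤-ι n) (expTerm-0≤ 0≤x (suc n))))
      where
      S τ : Carrier
      S = ∑ (suc n) (expTerm x)
      τ = expTerm x (suc n)

  exp-0 : exp 0# ≈ 1#
  exp-0 = trans (solve 1 (λ e → e := :1 :+ (e :- (:1 :+ :0))) refl (exp 0#))
    (trans (+-congˡ (0≤-antisym (1+x≤exp (0≤-≈0 refl))
        (0≤-resp (solve 1 (λ e → :1 :- (:1 :- :0) :* e := :- (e :- (:1 :+ :0)))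
             refl (exp 0#)) ([1-x]exp≤1 (0≤-≈0 refl)))))
      (+-identityʳ 1#))

  exp-inverse : ∀ x → exp x * exp (- x) ≈ 1#
  exp-inverse x = trans (sym (exp-+ x (- x))) (trans (exp-cong (-‿inverseʳ x)) exp-0)

  exp-0≤ : ∀ x → 0≤ exp x
  exp-0≤ x = 0≤-resp (trans (sym (exp-+ (½ * x) (½ * x)))
      (exp-cong (trans (sym (distribʳ x ½ ½)) (trans (*-congʳ ½+½≈1) (*-identityˡ x)))))
    (0≤-sq (exp (½ * x)))

  -- The goal being a negation, its failure may be assumed; then x < 0 is refuted by `[1-x]exp≤1` at
  -- `- x`, multiplied by `exp x`, and `1+x≤exp` covers the rest.
  exp-lower : ∀ x → 0≤ exp x - (1# + x)
  exp-lower x lt = 1+x≤exp 0≤x lt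
    where
    0≤x : 0≤ x
    0≤x x<0 = 0≤-resp
      (begin
        exp x * (1# - (1# - - x) * exp (- x))
          ≈⟨ solve 3 (λ e x f → e :* (:1 :- (:1 :- :- x) :* f) := e :- (:1 :+ x) :* (e :* f))
               refl (exp x) x (exp (- x)) ⟩
        exp x - (1# + x) * (exp x * exp (- x))
          ≈⟨ +-congˡ (-‿cong (trans (*-congˡ (exp-inverse x)) (*-identityʳ _))) ⟩
        exp x - (1# + x) ∎)
      (0≤-* (exp-0≤ x) ([1-x]exp≤1 (0<⇒0≤ (x<0⇒0<-x x<0)))) lt

  -- For x < 1 this is exp x ≤ 1 / (1 - x); the undivided form is valid for every x.
  exp-upper : ∀ x → 0≤ 1# - (1# - x) * exp x
  exp-upper x = 0≤-resp
    (begin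
      exp x * (exp (- x) - (1# + - x))
        ≈⟨ solve 3 (λ e x f → e :* (f :- (:1 :+ :- x)) := e :* f :- (:1 :- x) :* e) refl (exp x) x (exp (- x)) ⟩
      exp x * exp (- x) - (1# - x) * exp x
        ≈⟨ +-congʳ (exp-inverse x) ⟩
      1# - (1# - x) * exp x ∎)
    (0≤-* (exp-0≤ x) (exp-lower (- x)))

-- Derivatives with a quadratic error term.

module Derivatives {c ℓ₁ ℓ₂} (R : RealField c ℓ₁ ℓ₂) (E : RealDefs.ExpLn R) where

  open RealField R hiding (zero)
  open RealDefs R
  open RealDefs.ExpLn E
  open IntegerSolver commutativeRing
  open Order R
  open PowerSeries R
  open Polynomials R
  open Exponential R E
  open SetoidReasoning (CommutativeRing.setoid commutativeRing)

  0≤-square⁻ : ∀ {x m} → 0≤ m → 0≤ m * m - x * x → 0≤ m - x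
  0≤-square⁻ {x} {m} 0≤m 0≤m²-x² m-x<0 = 0≤m²-x² (0<-x⇒x<0 (0<-resp
    (solve 2 (λ x m → :- (m :- x) :* (:- (m :- x) :+ (m :+ m)) := :- (m :* m :- x :* x)) refl x m)
    (*-pos 0<x-m (0<-+-0≤ 0<x-m (0≤-+ 0≤m 0≤m)))))
    where
    0<x-m : 0# < - (m - x)
    0<x-m = x<0⇒0<-x m-x<0

  -- Serves for difference quotients, where comparing squares avoids cases on the sign of the
  -- divisor.
  ≼-square⁻ : ∀ {x m} → 0≤ m → 0≤ m * m - x * x → x ≼ m
  ≼-square⁻ {x} {m} 0≤m p = 0≤-square⁻ 0≤m p ,
    0≤-resp (solve 2 (λ x m → m :- :- x := m :+ x) refl x m)
      (0≤-square⁻ 0≤m (0≤-resp (solve 2 (λ x m → m :* m :- x :* x := m :* m :- :- x :* :- x) refl x m) p))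

  -- Lets the ring solver exploit an equation `p ≈ q`: the cofactor `d` is supplied by hand, and a
  -- polynomial identity remains.
  ≈-modulo : ∀ {a b p q} d → p ≈ q → a ≈ b + d * (p - q) → a ≈ b
  ≈-modulo {a} {b} {p} {q} d p≈q a≈ = begin
    a                  ≈⟨ a≈ ⟩
    b + d * (p - q)    ≈⟨ +-congˡ (*-congˡ (trans (+-congʳ p≈q) (-‿inverseʳ q))) ⟩
    b + d * 0#         ≈⟨ solve 2 (λ b d → b :+ d :* :0 := b) refl b d ⟩
    b                  ∎

  remainder : (ℝ₊ → Carrier) → (x : ℝ₊) → Carrier → ℝ₊ → Carrier
  remainder f x d y = f y - f x - d * (proj₁ y - proj₁ x)

  -- Differentiability with a quadratic error bound near x, which is closed
  -- under composition without any ε-bookkeeping.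
  Approx : (ℝ₊ → Carrier) → ℝ₊ → Carrier → Set _
  Approx f x d = ∃ λ C → ∃ λ δ → (0≤ C) × (0# < δ) ×
    (∀ y → proj₁ y - proj₁ x ≼ δ →
      remainder f x d y ≼ C * ((proj₁ y - proj₁ x) * (proj₁ y - proj₁ x)))

  Approx-resp : ∀ {f g x d e} → (∀ y → f y ≈ g y) → d ≈ e → Approx f x d → Approx g x e
  Approx-resp {x = x} f≈g d≈e (C , δ , 0≤C , 0<δ , bound) = C , δ , 0≤C , 0<δ , λ y h≼δ →
    ≼-resp (+-cong (+-cong (f≈g y) (-‿cong (f≈g x))) (-‿cong (*-congʳ d≈e))) refl (bound y h≼δ)

  Approx-zero : ∀ x → Approx (λ _ → 0#) x 0#
  Approx-zero x = 0# , 1# , 0≤-≈0 refl , 0<1 , λ y _ → ≼-resp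
    (solve 1 (λ h → :0 := :0 :- :0 :- :0 :* h) refl (proj₁ y - proj₁ x)) (sym (zeroˡ _)) (0≤⇒≼ (0≤-≈0 refl))

  Approx-scale : ∀ {f x d} p → Approx f x d → Approx (λ y → p * f y) x (p * d)
  Approx-scale {f} {x} {d} p (C , δ , 0≤C , 0<δ , bound) with bounded p
  ... | m , 0<m , p≼m = m * C , δ , 0≤-* (0<⇒0≤ 0<m) 0≤C , 0<δ , λ y h≼δ → ≼-resp
    (solve 5 (λ p f₁ f₀ d h → p :* (f₁ :- f₀ :- d :* h) := p :* f₁ :- p :* f₀ :- p :* d :* h)
      refl p (f y) (f x) d (proj₁ y - proj₁ x))
    (sym (*-assoc m C _)) (≼-* p≼m (bound y h≼δ))

  Approx-+ : ∀ {f g x d e} → Approx f x d → Approx g x e → Approx (λ y → f y + g y) x (d + e)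
  Approx-+ {f} {g} {x} {d} {e} (C , δ , 0≤C , 0<δ , bound) (C′ , δ′ , 0≤C′ , 0<δ′ , bound′)
    with lowerBound 0<δ 0<δ′
  ... | η , 0<η , η≤δ , η≤δ′ = C + C′ , η , 0≤-+ 0≤C 0≤C′ , 0<η , λ y h≼η → ≼-resp
    (solve 7 (λ f₁ f₀ g₁ g₀ d e h → f₁ :- f₀ :- d :* h :+ (g₁ :- g₀ :- e :* h) := f₁ :+ g₁ :- (f₀ :+ g₀) :- (d :+ e) :* h)
      refl (f y) (f x) (g y) (g x) d e (proj₁ y - proj₁ x))
    (sym (distribʳ _ C C′)) (≼-+ (bound y (≼-weaken h≼η η≤δ)) (bound′ y (≼-weaken h≼η η≤δ′)))

  Approx-∑ : ∀ n {x} (f : ℕ → ℝ₊ → Carrier) (d : ℕ → Carrier) → (∀ k → Approx (f k) x (d k)) →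
    Approx (λ y → ∑ n (λ k → f k y)) x (∑ n d)
  Approx-∑ zero    {x} f d approx = Approx-zero x
  Approx-∑ (suc n) {x} f d approx = Approx-+ {f 0} {λ y → ∑ n (λ k → f (suc k) y)} {x} {d 0} {∑ n (d ∘ suc)}
    (approx 0) (Approx-∑ n (f ∘ suc) (d ∘ suc) (approx ∘ suc))

  -- With e = exp k - 1 - k, `exp-upper` reads (1 - k) e ≤ k², and k ≤ ½ turns this into e ≤ 2 k².
  exp-quadratic : ∀ {k} → k ≼ ½ → exp k - 1# - k ≼ (k * k + k * k)
  exp-quadratic {k} (½-k , _) = ≼-weaken (0≤⇒≼ 0≤e) (0≤-resp
    (begin
      (1# - (1# - k) * exp k + (½ - k) * e) + (1# - (1# - k) * exp k + (½ - k) * e)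
        ≈⟨ ≈-modulo e ½+½≈1 (solve 3 (λ k x h →
             (:1 :- (:1 :- k) :* x :+ (h :- k) :* (x :- :1 :- k)) :+ (:1 :- (:1 :- k) :* x :+ (h :- k) :* (x :- :1 :- k))
             := k :* k :+ k :* k :- (x :- :1 :- k) :+ (x :- :1 :- k) :* (h :+ h :- :1)) refl k (exp k) ½) ⟩
      k * k + k * k - e ∎)
    (0≤-+ half half))
    where
    e : Carrier
    e = exp k - 1# - k
    0≤e : 0≤ e
    0≤e = 0≤-resp (solve 2 (λ x k → x :- (:1 :+ k) := x :- :1 :- k) refl (exp k) k) (exp-lower k)
    half : 0≤ 1# - (1# - k) * exp k + (½ - k) * e
    half = 0≤-+ (exp-upper k) (0≤-* ½-k 0≤e)

  -- With k = f y - f x and r the remainder of f, the new remainder is exp (f x) (exp k - 1 - k +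
  -- r).
  Approx-exp : ∀ {f x d} → Approx f x d → Approx (λ y → exp (f y)) x (exp (f x) * d)
  Approx-exp {f} {x} {d} (C , δ , 0≤C , 0<δ , bound) with bounded d
  -- The radius ρ is at most δ, so that the bound on r applies; at most 1, so that h² ≤ ρ; and at
  -- most ½ / (F + C), so that k = d h + r is bounded by (F + C) ρ ≤ ½, as `exp-quadratic` demands.
  ... | F , 0<F , d≼F with recip (0<-+-0≤ 0<F 0≤C) | lowerBound 0<δ 0<1
  ... | w , 0<w , [F+C]w≈1 | η , 0<η , η≤δ , η≤1 with lowerBound 0<η (*-pos 0<½ 0<w)
  ... | ρ , 0<ρ , ρ≤η , ρ≤½w = exp (f x) * (K + K + C) , ρ ,
    0≤-* (exp-0≤ (f x)) (0≤-+ (0≤-+ 0≤K 0≤K) 0≤C) , 0<ρ , approx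
    where
    K : Carrier
    K = F * F + C * C + (F * F + C * C)
    0≤K : 0≤ K
    0≤K = 0≤-+ (0≤-+ (0≤-sq F) (0≤-sq C)) (0≤-+ (0≤-sq F) (0≤-sq C))
    approx : ∀ y → proj₁ y - proj₁ x ≼ ρ → remainder (λ z → exp (f z)) x (exp (f x) * d) y ≼
      exp (f x) * (K + K + C) * ((proj₁ y - proj₁ x) * (proj₁ y - proj₁ x))
    approx y h≼ρ = ≼-resp
      (begin
        exp (f x) * (exp k - 1# - k + r)
          ≈⟨ solve 6 (λ X e f₁ f₀ d h → X :* (e :- :1 :- (f₁ :- f₀) :+ (f₁ :- f₀ :- d :* h)) := X :* e :- X :- X :* d :* h)
               refl (exp (f x)) (exp k) (f y) (f x) d h ⟩
        exp (f x) * exp k - exp (f x) - exp (f x) * d * h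
          ≈⟨ +-congʳ (+-congʳ (trans (sym (exp-+ (f x) k)) (exp-cong (solve 2 (λ a b → a :+ (b :- a) := b)
               refl (f x) (f y))))) ⟩
        exp (f y) - exp (f x) - exp (f x) * d * h ∎)
      (solve 4 (λ X K C h → X :* (K :* (h :* h) :+ K :* (h :* h) :+ C :* (h :* h)) := X :* (K :+ K :+ C) :* (h :* h))
        refl (exp (f x)) K C h)
      (≼-* (0≤⇒≼ (exp-0≤ (f x))) (≼-+ (≼-weaken (exp-quadratic k≼½) 2k²≤2Kh²) r≼Ch²))
      where
      h k r : Carrier
      h = proj₁ y - proj₁ x
      k = f y - f x
      r = remainder f x d y
      h≼η : h ≼ η
      h≼η = ≼-weaken h≼ρ ρ≤η
      h≼1 : h ≼ 1#
      h≼1 = ≼-weaken h≼η η≤1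
      r≼Ch² : r ≼ C * (h * h)
      r≼Ch² = bound y (≼-weaken h≼η η≤δ)
      k≈dh+r : d * h + r ≈ k
      k≈dh+r = solve 4 (λ f₁ f₀ d h → d :* h :+ (f₁ :- f₀ :- d :* h) := f₁ :- f₀) refl (f y) (f x) d h
      k≼½ : k ≼ ½
      k≼½ = ≼-weaken
        (≼-resp k≈dh+r refl (≼-+ (≼-* d≼F h≼ρ) (≼-weaken r≼Ch²
          (0≤-resp (solve 3 (λ C h t → C :* (t :* :1 :- h :* h) := C :* t :- C :* (h :* h)) refl C h ρ)
            (0≤-* 0≤C (proj₁ (≼-* h≼ρ h≼1)))))))
        (0≤-resp
          (≈-modulo ½ [F+C]w≈1 (solve 5 (λ F C h w t → (F :+ C) :* (h :* w :- t)
            := h :- (F :* t :+ C :* t) :+ h :* ((F :+ C) :* w :- :1)) refl F C ½ w ρ))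
          (0≤-* (0≤-+ (0<⇒0≤ 0<F) 0≤C) ρ≤½w))
      -- (u + v)² ≤ 2 u² + 2 v², applied to k = d h + r
      k²≤Kh² : 0≤ K * (h * h) - k * k
      k²≤Kh² = 0≤-resp
        (trans
          (solve 5 (λ F C d h r →
            (h :* h :* (F :* F :- d :* d) :+ (C :* (h :* h) :* (C :* (h :* h)) :- r :* r)
              :+ C :* C :* (h :* h) :* (:1 :* :1 :- h :* h))
            :+ (h :* h :* (F :* F :- d :* d) :+ (C :* (h :* h) :* (C :* (h :* h)) :- r :* r)
              :+ C :* C :* (h :* h) :* (:1 :* :1 :- h :* h))
            :+ (d :* h :- r) :* (d :* h :- r)
            := (F :* F :+ C :* C :+ (F :* F :+ C :* C)) :* (h :* h) :- (d :* h :+ r) :* (d :* h :+ r))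
            refl F C d h r)
          (+-congˡ (-‿cong (*-cong k≈dh+r k≈dh+r))))
        (0≤-+ (0≤-+ part part) (0≤-sq (d * h - r)))
        where
        part : 0≤ h * h * (F * F - d * d) + (C * (h * h) * (C * (h * h)) - r * r) + C * C * (h * h) * (1# * 1# - h * h)
        part = 0≤-+ (0≤-+ (0≤-* (0≤-sq h) (proj₁ (≼-* d≼F d≼F))) (proj₁ (≼-* r≼Ch² r≼Ch²)))
          (0≤-* (0≤-* (0≤-sq C) (0≤-sq h)) (proj₁ (≼-* h≼1 h≼1)))
      2k²≤2Kh² : 0≤ K * (h * h) + K * (h * h) - (k * k + k * k)
      2k²≤2Kh² = 0≤-resp (solve 2 (λ a b → a :- b :+ (a :- b) := a :+ a :- (b :+ b)) refl (K * (h * h)) (k * k))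
        (0≤-+ k²≤Kh² k²≤Kh²)

  -- 1 + t ≤ exp t at t = ± (ln y - ln x) gives (y - x) / y ≤ ln y - ln x ≤ (y - x) / x.
  Approx-ln : ∀ x → Approx ln x (exp (- ln x))
  -- Here w = 1 / x and v = 1 / y. The radius x / 2 ensures y ≥ x / 2, that is v ≤ 2 w. The two
  -- bounds on k = ln y - ln x put w h - k between 0 and (w - v) h = w v h² ≤ 2 w² h².
  Approx-ln x@(x₀ , 0<x₀) = w * w + w * w , ½ * x₀ ,
    0≤-+ (0≤-sq w) (0≤-sq w) , *-pos 0<½ 0<x₀ , approx
    where
    w : Carrier
    w = exp (- ln x)
    xw≈1 : x₀ * w ≈ 1#
    xw≈1 = trans (*-congʳ (sym (exp-ln x))) (exp-inverse (ln x))
    approx : ∀ y → proj₁ y - x₀ ≼ ½ * x₀ →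
      remainder ln x w y ≼ (w * w + w * w) * ((proj₁ y - x₀) * (proj₁ y - x₀))
    approx y@(y₀ , _) (_ , ½x+h) =
      0≤-resp (solve 3 (λ w h k → w :* h :- k :+ (w :* w :+ w :* w) :* (h :* h) := (w :* w :+ w :* w) :* (h :* h) :- (k :- w :* h))
           refl w h k)
        (0≤-+ k≤wh (0≤-* (0≤-+ (0≤-sq w) (0≤-sq w)) (0≤-sq h))) ,
      0≤-resp
        (≈-modulo (v * h) xw≈1 (≈-modulo (- (w * h)) yv≈1
          (solve 5 (λ x y w v k →
            k :- (y :- x) :* v :+ (y :- x) :* (y :- x) :* (w :* (w :+ w :- v))
            := (w :* w :+ w :* w) :* ((y :- x) :* (y :- x)) :+ (k :- w :* (y :- x))
               :+ v :* (y :- x) :* (x :* w :- :1) :+ :- (w :* (y :- x)) :* (y :* v :- :1)) refl x₀ y₀ w v k)))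
        (0≤-+ hv≤k (0≤-* (0≤-sq h) (0≤-* (exp-0≤ (- ln x)) v≤2w)))
      where
      v h k : Carrier
      v = exp (- ln y)
      h = y₀ - x₀
      k = ln y - ln x
      yv≈1 : y₀ * v ≈ 1#
      yv≈1 = trans (*-congʳ (sym (exp-ln y))) (exp-inverse (ln y))
      k≤wh : 0≤ w * h - k
      k≤wh = 0≤-resp
        (≈-modulo 1# xw≈1 (trans
          (+-congʳ (trans (exp-+ (ln y) (- ln x)) (*-congʳ (exp-ln y))))
          (solve 4 (λ x y w k → y :* w :- (:1 :+ k) := w :* (y :- x) :- k :+ :1 :* (x :* w :- :1)) refl x₀ y₀ w k)))
        (exp-lower k)
      hv≤k : 0≤ k - h * v
      hv≤k = 0≤-resp
        (≈-modulo 1# yv≈1 (trans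
          (+-congʳ (trans (exp-cong (solve 2 (λ a b → :- (a :- b) := b :+ :- a) refl (ln y) (ln x)))
            (trans (exp-+ (ln x) (- ln y)) (*-congʳ (exp-ln x)))))
          (solve 4 (λ x y v k → x :* v :- (:1 :+ :- k) := k :- (y :- x) :* v :+ :1 :* (y :* v :- :1))
               refl x₀ y₀ v k)))
        (exp-lower (- k))
      v≤2w : 0≤ w + w - v
      v≤2w = 0≤-resp
        (≈-modulo (w + w) yv≈1 (≈-modulo (- v) xw≈1 (≈-modulo (x₀ * v * w) ½+½≈1
          (solve 5 (λ x y w v a →
            (v :* w :+ v :* w) :* (a :* x :+ (y :- x))
            := w :+ w :- v :+ (w :+ w) :* (y :* v :- :1) :+ :- v :* (x :* w :- :1) :+ x :* v :* w :* (a :+ a :- :1))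
            refl x₀ y₀ w v ½))))
        (0≤-* (0≤-+ vw vw) ½x+h)
        where
        vw : 0≤ v * w
        vw = 0≤-* (exp-0≤ (- ln y)) (exp-0≤ (- ln x))

  Approx⇒IsDerivative : ∀ {f f′} → (∀ x → Approx f x (f′ x)) → IsDerivative f f′
  Approx⇒IsDerivative {f} {f′} approx x ε 0<ε with approx x
  -- Dividing ε by 1 + C instead of C keeps the divisor positive, and (1 + C) η ≤ ε leaves η as
  -- slack for the strict inequality C η < ε.
  ... | C , δ , 0≤C , 0<δ , bound with recip (0<-+-0≤ 0<1 0≤C)
  ... | w , 0<w , [1+C]w≈1 with lowerBound 0<δ (*-pos 0<ε 0<w)
  ... | η , 0<η , η≤δ , η≤εw = η , 0<η , λ y y#x ∣h∣<η → ≼⇒∣-∣<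
    (quotient y (#⇒invertible y#x) (∣-∣<⇒≼ ∣h∣<η))
    (0<y-x⇒x<y (0<-resp
      (≈-modulo ε [1+C]w≈1 (solve 4 (λ C ε w t → t :+ (:1 :+ C) :* (ε :* w :- t) := ε :- C :* t :+ ε :* ((:1 :+ C) :* w :- :1))
        refl C ε w η))
      (0<-+-0≤ 0<η (0≤-* (0≤-+ 0≤1 0≤C) η≤εw))))
    where
    quotient : ∀ y (inv : Invertible _≈_ 1# _*_ (proj₁ y - proj₁ x)) → proj₁ y - proj₁ x ≼ η →
      (f y - f x) * proj₁ inv - f′ x ≼ C * η
    -- As i = 1 / h, the error of the quotient is i times the remainder, with square at most i² C²
    -- h⁴ = C² h² ≤ C² η².
    quotient y (i , _ , hi≈1) h≼η = ≼-square⁻ (0≤-* 0≤C (0<⇒0≤ 0<η)) (0≤-resp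
      (≈-modulo m hi≈1 (solve 6 (λ C t h i D d →
        C :* C :* (t :* t :- h :* h) :+ i :* i :* (C :* (h :* h) :* (C :* (h :* h)) :- (D :- d :* h) :* (D :- d :* h))
        := C :* t :* (C :* t) :- (D :* i :- d) :* (D :* i :- d)
           :+ (C :* C :* (h :* h) :* (h :* i :+ :1) :- d :* d :* (h :* i :+ :1) :+ (d :* D :* i :+ d :* D :* i)) :* (h :* i :- :1))
        refl C η h i (f y - f x) d))
      (0≤-+ (0≤-* (0≤-sq C) (proj₁ (≼-* h≼η h≼η)))
        (0≤-* (0≤-sq i) (proj₁ (≼-* r≼Ch² r≼Ch²)))))
      where
      h d m : Carrier
      h = proj₁ y - proj₁ x
      d = f′ x
      m = C * C * (h * h) * (h * i + 1#) - d * d * (h * i + 1#) + (d * (f y - f x) * i + d * (f y - f x) * i)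
      r≼Ch² : remainder f x d y ≼ C * (h * h)
      r≼Ch² = bound y (≼-weaken h≼η η≤δ)

  exp-^ : ∀ k x → exp (ι k * x) ≈ exp x ^ k
  exp-^ zero    x = trans (exp-cong (zeroˡ x)) exp-0
  exp-^ (suc k) x = begin
    exp ((1# + ι k) * x)       ≈⟨ exp-cong (solve 2 (λ i x → (:1 :+ i) :* x := x :+ i :* x) refl (ι k) x) ⟩
    exp (x + ι k * x)          ≈⟨ exp-+ x (ι k * x) ⟩
    exp x * exp (ι k * x)      ≈⟨ *-congˡ (exp-^ k x) ⟩
    exp x * exp x ^ k          ∎

  [-1]^-square : ∀ n → (- 1#) ^ n * (- 1#) ^ n ≈ 1#
  [-1]^-square zero    = *-identityˡ 1#
  [-1]^-square (suc n) = trans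
    (solve 1 (λ s → :- :1 :* s :* (:- :1 :* s) := s :* s) refl ((- 1#) ^ n)) ([-1]^-square n)

  -- The Rodrigues formulas.

  module Rodrigues (α β : Carrier) where

    F : Carrier → ℝ₊ → Carrier
    F γ x = (x ^ᴿ γ) * exp (x ^ᴿ β)

    F-cong : ∀ {γ δ} x → γ ≈ δ → F γ x ≈ F δ x
    F-cong x γ≈δ = *-congʳ (exp-cong (*-congʳ γ≈δ))

    -- Since `F γ` is the single exponential exp (γ ln y + exp (β ln y)), sums, scalings and the
    -- chain rule for `exp` suffice, and a product rule is avoided.
    Approx-F : ∀ γ x → Approx (F γ) x (γ * F (γ - 1#) x + β * F (γ + β - 1#) x)
    Approx-F γ x = Approx-resp (λ y → exp-+ (γ * ln y) (exp (β * ln y))) derivative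
      (Approx-exp (Approx-+ (Approx-scale γ (Approx-ln x)) (Approx-exp (Approx-scale β (Approx-ln x)))))
      where
      L w X Y Z : Carrier
      L = ln x
      w = exp (- L)
      X = exp (γ * L)
      Y = exp (β * L)
      Z = exp Y
      derivative : exp (γ * L + Y) * (γ * w + Y * (β * w)) ≈ γ * F (γ - 1#) x + β * F (γ + β - 1#) x
      derivative = begin
        exp (γ * L + Y) * (γ * w + Y * (β * w))
          ≈⟨ *-congʳ (exp-+ (γ * L) Y) ⟩
        X * Z * (γ * w + Y * (β * w))
          ≈⟨ solve 6 (λ X Z γ w Y β → X :* Z :* (γ :* w :+ Y :* (β :* w)) := γ :* (X :* w :* Z) :+ β :* (X :* Y :* w :* Z))
               refl X Z γ w Y β ⟩
        γ * (X * w * Z) + β * (X * Y * w * Z)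
          ≈⟨ +-cong (*-congˡ (*-congʳ (trans (sym (exp-+ (γ * L) (- L)))
                 (exp-cong (solve 2 (λ γ L → γ :* L :+ :- L := (γ :- :1) :* L) refl γ L)))))
               (*-congˡ (*-congʳ (trans (*-congʳ (sym (exp-+ (γ * L) (β * L)))) (trans (sym (exp-+ (γ * L + β * L) (- L)))
                 (exp-cong (solve 3 (λ γ β L → γ :* L :+ β :* L :+ :- L := (γ :+ β :- :1) :* L) refl γ β L)))))) ⟩
        γ * F (γ - 1#) x + β * F (γ + β - 1#) x ∎

    exponent : ℕ → ℕ → Carrier
    exponent n k = α - ι n + ι k * β

    D : ℕ → ℝ₊ → Carrier
    D n x = (- 1#) ^ n * ∑ (suc n) (λ k → coeff α β n k * F (exponent n k) x)

    D-derivative : ∀ n → IsDerivative (D n) (D (suc n))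
    D-derivative n = Approx⇒IsDerivative λ x →
      Approx-resp {D n} {D n} (λ _ → refl) (derivative x)
        (Approx-scale {λ y → ∑ (suc n) (λ k → coeff α β n k * F (exponent n k) y)} ((- 1#) ^ n)
          (Approx-∑ (suc n) (λ k y → coeff α β n k * F (exponent n k) y) (λ k → coeff α β n k * F′ x k)
            (λ k → Approx-scale (coeff α β n k) (Approx-F (exponent n k) x))))
      where
      F′ : ℝ₊ → ℕ → Carrier
      F′ x k = exponent n k * F (exponent n k - 1#) x + β * F (exponent n k + β - 1#) x

      derivative : ∀ x → (- 1#) ^ n * ∑ (suc n) (λ k → coeff α β n k * F′ x k) ≈ D (suc n) x
      derivative x = begin
        (- 1#) ^ n * ∑ (suc n) (λ k → coeff α β n k * F′ x k)
          ≈⟨ *-congˡ (∑-cong (suc n) term) ⟩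
        (- 1#) ^ n * ∑ (suc n) (λ k → - 1# * g k)
          ≈⟨ *-congˡ (∑-scale (suc n) (- 1#) g) ⟩
        (- 1#) ^ n * (- 1# * ∑ (suc n) g)
          ≈⟨ solve 2 (λ s t → s :* (:- :1 :* t) := :- :1 :* s :* t) refl ((- 1#) ^ n) (∑ (suc n) g) ⟩
        (- 1#) ^ suc n * ∑ (suc n) g
          ≈⟨ *-congˡ (coeff-recurrence α β n φ) ⟨
        D (suc n) x ∎
        where
        φ g : ℕ → Carrier
        φ k = F (exponent (suc n) k) x
        g k = coeff α β n k * ((ι n - α - ι k * β) * φ k - β * φ (suc k))
        -- Differentiating x^γ lowers `exponent n k` to `exponent (suc n) k`; differentiating exp
        -- (x^β) moves it to `exponent (suc n) (suc k)`. These give the `φ k` and `φ (suc k)` of the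
        -- recurrence.
        term : ∀ k → coeff α β n k * F′ x k ≈ - 1# * g k
        term k = trans
          (*-congˡ (+-cong
            (*-congˡ (F-cong x (solve 4 (λ α i j β → α :- i :+ j :* β :- :1 := α :- (:1 :+ i) :+ j :* β)
                 refl α (ι n) (ι k) β)))
            (*-congˡ (F-cong x (solve 4 (λ α i j β → α :- i :+ j :* β :+ β :- :1 := α :- (:1 :+ i) :+ (:1 :+ j) :* β)
                 refl α (ι n) (ι k) β)))))
          (solve 7 (λ a α i j β u v → a :* ((α :- i :+ j :* β) :* u :+ β :* v)
            := :- :1 :* (a :* ((i :- α :- j :* β) :* u :- β :* v)))
                 refl (coeff α β n k) α (ι n) (ι k) β (φ k) (φ (suc k)))

    D-isNthDerivative : ∀ n → IsNthDerivative n (F α) (D n)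
    D-isNthDerivative zero x = sym (begin
      1# * (1# * 1# * (1# ÷! 0) * F (exponent 0 0) x + 0#)
        ≈⟨ *-congˡ (+-congʳ (*-cong (*-congˡ (expTerm-zero 0#))
             (F-cong x (solve 2 (λ α β → α :- :0 :+ :0 :* β := α) refl α β)))) ⟩
      1# * (1# * 1# * 1# * F α x + 0#)
        ≈⟨ solve 1 (λ f → :1 :* (:1 :* :1 :* :1 :* f :+ :0) := f) refl (F α x) ⟩
      F α x ∎)
    D-isNthDerivative (suc n) = D n , D-isNthDerivative n , D-derivative n

    P-rodrigues : ∀ n x →
      P α β n (x ^ᴿ β) ≈ (- 1#) ^ n * (x ^ᴿ (ι n - α)) * exp (- (x ^ᴿ β)) * D n x
    P-rodrigues n x = begin
      P α β n Y
        ≈⟨ P-expansion α β n Y ⟩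
      ∑ (suc n) (λ k → coeff α β n k * Y ^ k)
        ≈⟨ ∑-cong (suc n) term ⟩
      ∑ (suc n) (λ k → X * Z′ * t k)
        ≈⟨ ∑-scale (suc n) (X * Z′) t ⟩
      X * Z′ * ∑ (suc n) t
        -- The sign occurs both in the formula and inside `D`, so a factor s² = 1 is introduced.
        ≈⟨ *-identityˡ _ ⟨
      1# * (X * Z′ * ∑ (suc n) t)
        ≈⟨ *-congʳ ([-1]^-square n) ⟨
      s * s * (X * Z′ * ∑ (suc n) t)
        ≈⟨ solve 4 (λ s X Z t → s :* s :* (X :* Z :* t) := s :* X :* Z :* (s :* t)) refl s X Z′ (∑ (suc n) t) ⟩
      s * X * Z′ * (s * ∑ (suc n) t) ∎
      where
      L s X Y Z′ : Carrier
      L = ln x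
      s = (- 1#) ^ n
      X = exp ((ι n - α) * L)
      Y = exp (β * L)
      Z′ = exp (- Y)
      t : ℕ → Carrier
      t k = coeff α β n k * F (exponent n k) x
      power : ∀ k → Y ^ k ≈ X * exp (exponent n k * L)
      power k = begin
        Y ^ k                                     ≈⟨ exp-^ k (β * L) ⟨
        exp (ι k * (β * L))                       ≈⟨ exp-cong (solve 5 (λ i α j β L → j :* (β :* L) := (i :- α) :* L :+ (α :- i :+ j :* β) :* L)
             refl (ι n) α (ι k) β L) ⟩
        exp ((ι n - α) * L + exponent n k * L)    ≈⟨ exp-+ _ _ ⟩
        X * exp (exponent n k * L)                ∎
      term : ∀ k → coeff α β n k * Y ^ k ≈ X * Z′ * t k
      term k = begin
        coeff α β n k * Y ^ k
          ≈⟨ *-congˡ (power k) ⟩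
        coeff α β n k * (X * exp (exponent n k * L))
          ≈⟨ *-identityʳ _ ⟨
        coeff α β n k * (X * exp (exponent n k * L)) * 1#
          ≈⟨ *-congˡ (exp-inverse Y) ⟨
        coeff α β n k * (X * exp (exponent n k * L)) * (exp Y * Z′)
          ≈⟨ solve 5 (λ a X e z w → a :* (X :* e) :* (z :* w) := X :* w :* (a :* (e :* z)))
               refl (coeff α β n k) X (exp (exponent n k * L)) (exp Y) Z′ ⟩
        X * Z′ * t k ∎

  -- The sign from the reflection cancels the one in the first formula, and with α′ = n - 1 - α the
  -- outer exponent n - α′ becomes α + 1.
  P-rodrigues-reflected : ∀ α β n x → P α β n (x ^ᴿ (- β)) ≈
    (x ^ᴿ (α + 1#)) * exp (- (x ^ᴿ (- β))) * Rodrigues.D (ι n - 1# - α) (- β) n x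
  P-rodrigues-reflected α β n x = begin
    P α β n Y
      ≈⟨ P-reflect α β n Y ⟩
    s * P α′ (- β) n Y
      ≈⟨ *-congˡ (Rodrigues.P-rodrigues α′ (- β) n x) ⟩
    s * (s * (x ^ᴿ (ι n - α′)) * Z′ * D)
      ≈⟨ solve 4 (λ s X Z D → s :* (s :* X :* Z :* D) := s :* s :* (X :* Z :* D)) refl s _ Z′ D ⟩
    s * s * ((x ^ᴿ (ι n - α′)) * Z′ * D)
      ≈⟨ trans (*-congʳ ([-1]^-square n)) (*-identityˡ _) ⟩
    (x ^ᴿ (ι n - α′)) * Z′ * D
      ≈⟨ *-congʳ (*-congʳ (exp-cong (*-congʳ (solve 2 (λ i α → i :- (i :- :1 :- α) := α :+ :1) refl (ι n) α)))) ⟩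
    (x ^ᴿ (α + 1#)) * Z′ * D ∎
    where
    α′ s Y Z′ D : Carrier
    α′ = ι n - 1# - α
    s = (- 1#) ^ n
    Y = x ^ᴿ (- β)
    Z′ = exp (- Y)
    D = Rodrigues.D α′ (- β) n x

theorem1 : ∀ {c ℓ₁ ℓ₂} (R : RealField c ℓ₁ ℓ₂) (E : RealDefs.ExpLn R) →
  let open RealField R
      open RealDefs R
      open ExpLn E
  in
  ∀ (α β : Carrier) → ¬ (β ≈ 0#) → ∀ (n : ℕ) →
    (∃ λ (D : ℝ₊ → Carrier) →
      IsNthDerivative n (λ x → (x ^ᴿ α) * exp (x ^ᴿ β)) D ×
      (∀ (x : ℝ₊) →
        P α β n (x ^ᴿ β)
          ≈ ((- 1#) ^ n) * (x ^ᴿ (ι n - α)) * exp (- (x ^ᴿ β)) * D x))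
    ×
    (∃ λ (D : ℝ₊ → Carrier) →
      IsNthDerivative n (λ x → (x ^ᴿ (ι n - 1# - α)) * exp (x ^ᴿ (- β))) D ×
      (∀ (x : ℝ₊) →
        P α β n (x ^ᴿ (- β))
          ≈ (x ^ᴿ (α + 1#)) * exp (- (x ^ᴿ (- β))) * D x))
theorem1 R E α β _ n =
  (Rodrigues.D α β n , Rodrigues.D-isNthDerivative α β n , Rodrigues.P-rodrigues α β n) ,
  (Rodrigues.D (ι n - 1# - α) (- β) n , Rodrigues.D-isNthDerivative (ι n - 1# - α) (- β) n ,
    P-rodrigues-reflected α β n)
  where
  open RealField R
  open Derivatives R E
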